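{- Let $\xi$ be a refining quadratic map and $\alpha,\beta\in\mathbf{DIG}^{\omega}$. Then $P_q(\xi,\alpha,\beta)$ holds.
   Context: Quadratic maps. $\mathbb{T}=\mathbb{Q}^8$ is the set of quadratic maps, i.e. rational tensors $\xi=\left[\begin{smallmatrix} a & b & c & d \\ e & f & g & h \end{smallmatrix}\right]$, acting by $\xi(x,y)=\frac{axy+bx+cy+d}{exy+fx+gy+h}$. $\xi$ is bounded if its denominator does not vanish on $[-1,1]\times[-1,1]$; $\xi$ is refining if it is bounded and $\xi([-1,1]\times[-1,1])\subseteq[-1,1]$. For a rational matrix (Möbius map) $\mu=\left[\begin{smallmatrix} p & q \\ r & s \end{smallmatrix}\right]$, $\mu(x)=\frac{px+q}{rx+s}$, the composition $\mu\circ\xi$ is the product of $\mu$ with the $2\times4$ matrix $\xi$ (it represents $\mu(\xi(x,y))$); $\xi\bullet_1\mu$ is the tensor representing $\xi(\mu(x),y)$, in which each row $(a,b,c,d)$ of $\xi$ is replaced by $(ap+cr,\,bp+dr,\,aq+cs,\,bq+ds)$; $\xi\bullet_2\mu$ is the tensor representing $\xi(x,\mu(y))$, in which each row $(a,b,c,d)$ is replaced by $(ap+br,\,aq+bs,\,cp+dr,\,cq+ds)$. $\phi^{ -1}$ is the matrix inverse. Digits. $\mathbf{DIG}=\{\mathbf L,\mathbf R,\mathbf M\}$, interpreted as the matrices $\mathbf L=\left[\begin{smallmatrix} 1/2 & -1/2 \\ 1/2 & 3/2 \end{smallmatrix}\right]$, $\mathbf R=\left[\begin{smallmatrix} 1/2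 & 1/2 \\ -1/2 & 3/2 \end{smallmatrix}\right]$, $\mathbf M=\left[\begin{smallmatrix} 1 & 0 \\ 0 & 3 \end{smallmatrix}\right]$. $\mathbf{DIG}^{\omega}$ is the type of infinite streams over $\mathbf{DIG}$, with head $\mathsf{hd}$ and tail $\mathsf{tl}$. For $\xi\in\mathbb{T}$, $\phi\in\mathbf{DIG}$, the decidable emission condition $\mathbf{Incl}(\xi,\phi)$ means: $\xi$ is bounded and $\xi([-1,1]\times[-1,1])\subseteq\phi([-1,1])$. Productivity predicate. $E_q(\xi,\alpha,\beta)$ is the inductively defined (least) predicate with rules: if $\mathbf{Incl}(\xi,\phi)$ for some $\phi\in\mathbf{DIG}$ then $E_q(\xi,\alpha,\beta)$ (one rule per digit); if $E_q((\xi\bullet_1\mathsf{hd}(\alpha))\bullet_2\mathsf{hd}(\beta),\mathsf{tl}(\alpha),\mathsf{tl}(\beta))$ then $E_q(\xi,\alpha,\beta)$. For a proof $t$ of $E_q(\xi,\alpha,\beta)$, the quadruple $\overline m_q(\xi,\alpha,\beta,t)\in\mathbf{DIG}\times\mathbb{T}\times\mathbf{DIG}^{\omega}\times\mathbf{DIG}^{\omega}$ is defined by structural recursion on $t$: it is $(\mathbf L,\mathbf L^{ -1}\circ\xi,\alpha,\beta)$ if $\mathbf{Incl}(\xi,\mathbf L)$; else $(\mathbf R,\mathbf R^{ -1}\circ\xi,\alpha,\beta)$ if $\mathbf{Incl}(\xi,\mathbf R)$; else $(\mathbf M,\mathbf M^{ -1}\circ\xi,\alpha,\beta)$ if $\mathbf{Incl}(\xi,\mathbf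 M)$; otherwise $\overline m_q((\xi\bullet_1\mathsf{hd}(\alpha))\bullet_2\mathsf{hd}(\beta),\mathsf{tl}(\alpha),\mathsf{tl}(\beta),t')$ with $t'$ obtained from $t$ by inversion. $\Psi_q(n,\xi,\alpha,\beta)$ ($n\in\mathbb{N}$) is the inductive predicate with rules: $E_q(\xi,\alpha,\beta)$ implies $\Psi_q(0,\xi,\alpha,\beta)$; for a proof $t$ of $E_q(\xi,\alpha,\beta)$ with $\overline m_q(\xi,\alpha,\beta,t)=(\phi,\xi',\alpha',\beta')$, $\Psi_q(n,\xi',\alpha',\beta')$ implies $\Psi_q(n+1,\xi,\alpha,\beta)$. Finally $P_q(\xi,\alpha,\beta):\Leftrightarrow\forall n\in\mathbb{N},\ \Psi_q(n,\xi,\alpha,\beta)$. -}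

module Defs where

import Data.Integer as ℤ
open import Data.Nat as ℕ using (ℕ; zero; suc)
import Data.Nat.Properties as ℕ
open import Data.Product using (Σ-syntax; ∃-syntax; _×_; _,_; proj₁; proj₂)
open import Data.Rational
open import Data.Rational.Properties
open import Data.Rational.Solver using (module +-*-Solver)
open import Data.Sum using (_⊎_; inj₁; inj₂)
open import Relation.Binary.Definitions using (tri<; tri≈; tri>)
open import Relation.Binary.PropositionalEquality using (_≡_; _≢_; refl; sym; trans; cong; cong₂; subst)
open import Relation.Nullary using (Dec; yes; no; ¬_; contradiction)
open import Relation.Nullary.Decidable using (_×-dec_; True; toWitness)

------------------------------------------------------------------------
-- Rational arithmetic

open +-*-Solver using (solve; con; _:=_; _:+_; _:*_; _:-_; :-_)

-- Only finitely many terms of a Cauchy sequence bounded away from 0 can vanish,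
-- so the value at 0ℚ does not affect the reciprocal of a real.
recip : ℚ → ℚ
recip q with q ≟ 0ℚ
... | yes _  = 0ℚ
... | no q≢0 = (1/ q) {{≢-nonZero q≢0}}

*-recip : ∀ {q} → q ≢ 0ℚ → q * recip q ≡ 1ℚ
*-recip {q} q≢0 with q ≟ 0ℚ
... | yes q≡0 = contradiction q≡0 q≢0
... | no q≢0′ = *-inverseʳ q {{≢-nonZero q≢0′}}

≤-dec : ∀ {p q} {_ : True (p ≤? q)} → p ≤ q
≤-dec {_} {_} {h} = toWitness h

<-dec : ∀ {p q} {_ : True (p <? q)} → p < q
<-dec {_} {_} {h} = toWitness h

0<1 : 0ℚ < 1ℚ
0<1 = <-dec

0<½ : 0ℚ < ½
0<½ = <-dec

0≤1 : 0ℚ ≤ 1ℚ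
0≤1 = <⇒≤ 0<1

<⇒≢0 : ∀ {q} → 0ℚ < q → q ≢ 0ℚ
<⇒≢0 0<q refl = <-irrefl refl 0<q

*-pos : ∀ {p q} → 0ℚ < p → 0ℚ < q → 0ℚ < p * q
*-pos {p} {q} 0<p 0<q =
  positive⁻¹ _ {{pos*pos⇒pos p {{positive 0<p}} q {{positive 0<q}}}}

*-nonNeg : ∀ {p q} → 0ℚ ≤ p → 0ℚ ≤ q → 0ℚ ≤ p * q
*-nonNeg {p} {q} 0≤p 0≤q =
  nonNegative⁻¹ _ {{nonNeg*nonNeg⇒nonNeg p {{nonNegative 0≤p}} q {{nonNegative 0≤q}}}}

*-mono-≤ : ∀ {p q r s} → 0ℚ ≤ r → 0ℚ ≤ q → p ≤ q → r ≤ s → p * r ≤ q * s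
*-mono-≤ {p} {q} {r} {s} 0≤r 0≤q p≤q r≤s = ≤-trans
  (*-monoʳ-≤-nonNeg r {{nonNegative 0≤r}} p≤q)
  (*-monoˡ-≤-nonNeg q {{nonNegative 0≤q}} r≤s)

*-cancel-pos : ∀ {p q} → 0ℚ < p → 0ℚ < p * q → 0ℚ < q
*-cancel-pos {p} {q} 0<p 0<pq = *-cancelˡ-<-nonNeg p {{nonNegative (<⇒≤ 0<p)}}
  (subst (_< p * q) (sym (*-zeroʳ p)) 0<pq)

+-nonNeg : ∀ {p q} → 0ℚ ≤ p → 0ℚ ≤ q → 0ℚ ≤ p + q
+-nonNeg = +-mono-≤

≤⇒0≤- : ∀ {p q} → p ≤ q → 0ℚ ≤ q - p
≤⇒0≤- {p} {q} p≤q = subst (_≤ q - p) (+-inverseʳ p) (+-monoˡ-≤ (- p) p≤q)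

0≤-⇒≤ : ∀ {p q} → 0ℚ ≤ q - p → p ≤ q
0≤-⇒≤ {p} {q} h = subst₂′ (+-identityˡ p) (solve 2 (λ p q → (q :- p) :+ p := q) refl p q)
  (+-monoˡ-≤ p h)
  where
  subst₂′ : ∀ {a b c d} → a ≡ b → c ≡ d → a ≤ c → b ≤ d
  subst₂′ refl refl h = h

+-pos : ∀ {p q} → 0ℚ < p → 0ℚ < q → 0ℚ < p + q
+-pos = +-mono-<

recip-pos : ∀ {q} → 0ℚ < q → 0ℚ < recip q
recip-pos {q} 0<q = *-cancel-pos 0<q (subst (0ℚ <_) (sym (*-recip (<⇒≢0 0<q))) 0<1)

shrink : ∀ {B ε} → 0ℚ < B → 0ℚ < ε → Σ[ δ ∈ ℚ ] (0ℚ < δ × B * δ ≡ ε)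
shrink {B} {ε} 0<B 0<ε = recip B * ε , *-pos (recip-pos 0<B) 0<ε ,
  trans (sym (*-assoc B (recip B) ε))
    (trans (cong (_* ε) (*-recip (<⇒≢0 0<B))) (*-identityˡ ε))

halve : ∀ {ε} → 0ℚ < ε → Σ[ δ ∈ ℚ ] (0ℚ < δ × δ + δ ≡ ε)
halve {ε} 0<ε = ½ * ε , *-pos 0<½ 0<ε ,
  solve 1 (λ ε → con ½ :* ε :+ con ½ :* ε := ε) refl ε

q≤∣q∣ : ∀ q → q ≤ ∣ q ∣
q≤∣q∣ q with ≤-total 0ℚ q
... | inj₁ 0≤q = ≤-reflexive (sym (0≤p⇒∣p∣≡p 0≤q))
... | inj₂ q≤0 = ≤-trans q≤0 (0≤∣p∣ q)

∣q∣≤ : ∀ {q ε} → q ≤ ε → - q ≤ ε → ∣ q ∣ ≤ ε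
∣q∣≤ {q} h h′ with ∣p∣≡p∨∣p∣≡-p q
... | inj₁ e = subst (_≤ _) (sym e) h
... | inj₂ e = subst (_≤ _) (sym e) h′

∣-∣-swap : ∀ p q → ∣ p - q ∣ ≡ ∣ q - p ∣
∣-∣-swap p q = trans (sym (∣-p∣≡∣p∣ (p - q)))
  (cong ∣_∣ (solve 2 (λ p q → :- (p :- q) := q :- p) refl p q))

∣-∣-triangle : ∀ p q r → ∣ p - r ∣ ≤ ∣ p - q ∣ + ∣ q - r ∣
∣-∣-triangle p q r = subst (λ z → ∣ z ∣ ≤ ∣ p - q ∣ + ∣ q - r ∣)
  (solve 3 (λ p q r → (p :- q) :+ (q :- r) := p :- r) refl p q r)
  (∣p+q∣≤∣p∣+∣q∣ (p - q) (q - r))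

∣recip∣≤ : ∀ {δ q} → 0ℚ < δ → δ ≤ ∣ q ∣ → ∣ recip q ∣ ≤ recip δ
∣recip∣≤ {δ} {q} 0<δ δ≤∣q∣ = begin
  ∣ u ∣                    ≡⟨ sym (*-identityˡ ∣ u ∣) ⟩
  1ℚ * ∣ u ∣               ≡⟨ cong (_* ∣ u ∣) (sym (*-recip (<⇒≢0 0<δ))) ⟩
  δ * recip δ * ∣ u ∣      ≡⟨ solve 3 (λ a b c → a :* b :* c := b :* (a :* c)) refl δ (recip δ) ∣ u ∣ ⟩
  recip δ * (δ * ∣ u ∣)    ≤⟨ *-monoˡ-≤-nonNeg (recip δ) {{nonNegative (<⇒≤ (recip-pos 0<δ))}}
                                (*-monoʳ-≤-nonNeg ∣ u ∣ {{nonNegative (0≤∣p∣ u)}} δ≤∣q∣) ⟩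
  recip δ * (∣ q ∣ * ∣ u ∣) ≡⟨ cong (recip δ *_) (sym (∣p*q∣≡∣p∣*∣q∣ q u)) ⟩
  recip δ * ∣ q * u ∣      ≡⟨ cong (λ z → recip δ * ∣ z ∣) (*-recip q≢0) ⟩
  recip δ * 1ℚ             ≡⟨ *-identityʳ (recip δ) ⟩
  recip δ ∎
  where
  open ≤-Reasoning
  u = recip q
  q≢0 : q ≢ 0ℚ
  q≢0 refl = <-irrefl refl (<-≤-trans 0<δ δ≤∣q∣)

------------------------------------------------------------------------
-- Real numbers as Cauchy sequences of rationals

-- Close s s says that s is a Cauchy sequence; for Cauchy sequences s and t,
-- Close s t says that s - t tends to 0.
Close : (ℕ → ℚ) → (ℕ → ℚ) → Set
Close s t = ∀ ε → 0ℚ < ε → ∃[ N ] (∀ m n → N ℕ.≤ m → N ℕ.≤ n → ∣ s m - t n ∣ ≤ ε)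

Apart₀ : (ℕ → ℚ) → Set
Apart₀ s = ∃[ δ ] (0ℚ < δ × ∃[ N ] (∀ n → N ℕ.≤ n → δ ≤ ∣ s n ∣))

⊔-ub : ∀ M N {n} → M ℕ.⊔ N ℕ.≤ n → M ℕ.≤ n × N ℕ.≤ n
⊔-ub M N h = ℕ.≤-trans (ℕ.m≤m⊔n M N) h , ℕ.≤-trans (ℕ.m≤n⊔m M N) h

Close-const : ∀ q → Close (λ _ → q) (λ _ → q)
Close-const q ε 0<ε = 0 , λ _ _ _ _ →
  subst (λ z → ∣ z ∣ ≤ ε) (sym (+-inverseʳ q)) (<⇒≤ 0<ε)

Close-sym : ∀ {s t} → Close s t → Close t s
Close-sym {s} {t} st ε 0<ε = let N , h = st ε 0<ε in
  N , λ m n N≤m N≤n → subst (_≤ ε) (∣-∣-swap (s n) (t m)) (h n m N≤n N≤m)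

Close-trans : ∀ {s t u} → Close s t → Close t u → Close s u
Close-trans {s} {t} {u} st tu ε 0<ε = let
  δ , 0<δ , δ+δ≡ε = halve 0<ε
  M , f = st δ 0<δ
  N , g = tu δ 0<δ
  in M ℕ.⊔ N , λ m n hm hn → ≤-trans
  (∣-∣-triangle (s m) (t (M ℕ.⊔ N)) (u n))
  (≤-trans (+-mono-≤ (f m (M ℕ.⊔ N) (proj₁ (⊔-ub M N hm)) (ℕ.m≤m⊔n M N))
                     (g (M ℕ.⊔ N) n (ℕ.m≤n⊔m M N) (proj₂ (⊔-ub M N hn))))
           (≤-reflexive δ+δ≡ε))

Close-+ : ∀ {s s′ t t′} → Close s s′ → Close t t′ →
          Close (λ n → s n + t n) (λ n → s′ n + t′ n)
Close-+ {s} {s′} {t} {t′} ss tt ε 0<ε = let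
  δ , 0<δ , δ+δ≡ε = halve 0<ε
  M , f = ss δ 0<δ
  N , g = tt δ 0<δ
  in M ℕ.⊔ N , λ m n hm hn → begin
  ∣ s m + t m - (s′ n + t′ n) ∣
    ≡⟨ cong ∣_∣ (solve 4 (λ a b c d → a :+ b :- (c :+ d) := (a :- c) :+ (b :- d)) refl
                  (s m) (t m) (s′ n) (t′ n)) ⟩
  ∣ (s m - s′ n) + (t m - t′ n) ∣
    ≤⟨ ∣p+q∣≤∣p∣+∣q∣ (s m - s′ n) (t m - t′ n) ⟩
  ∣ s m - s′ n ∣ + ∣ t m - t′ n ∣
    ≤⟨ +-mono-≤ (f m n (proj₁ (⊔-ub M N hm)) (proj₁ (⊔-ub M N hn)))
                (g m n (proj₂ (⊔-ub M N hm)) (proj₂ (⊔-ub M N hn))) ⟩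
  δ + δ
    ≡⟨ δ+δ≡ε ⟩
  ε ∎
  where open ≤-Reasoning

bounded : ∀ {s t} → Close s t →
          ∃[ B ] (0ℚ < B × ∃[ N ] (∀ n → N ℕ.≤ n → ∣ s n ∣ ≤ B))
bounded {s} {t} st = let N , h = st 1ℚ 0<1 in
  1ℚ + ∣ t N ∣ , +-mono-<-≤ 0<1 (0≤∣p∣ (t N)) , N , λ n N≤n →
  subst (λ z → ∣ z ∣ ≤ 1ℚ + ∣ t N ∣)
    (solve 2 (λ a b → (a :- b) :+ b := a) refl (s n) (t N))
    (≤-trans (∣p+q∣≤∣p∣+∣q∣ (s n - t N) (t N))
      (+-monoˡ-≤ ∣ t N ∣ (h n N N≤n ℕ.≤-refl)))

Close-* : ∀ {s s′ t t′} → Close s s′ → Close t t′ →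
          Close (λ n → s n * t n) (λ n → s′ n * t′ n)
Close-* {s} {s′} {t} {t′} ss tt ε 0<ε = let
  B , 0<B , M , b = bounded {s} {s′} ss
  C , 0<C , N , c = bounded {t′} {t} (Close-sym {t} {t′} tt)
  δ , 0<δ , Bδ≡ε = shrink (+-pos 0<B 0<C) 0<ε
  K , f = ss δ 0<δ
  L , g = tt δ 0<δ
  in (M ℕ.⊔ N) ℕ.⊔ (K ℕ.⊔ L) , λ m n hm hn →
  let hmM = proj₁ (⊔-ub M N (proj₁ (⊔-ub (M ℕ.⊔ N) (K ℕ.⊔ L) hm)))
      hnN = proj₂ (⊔-ub M N (proj₁ (⊔-ub (M ℕ.⊔ N) (K ℕ.⊔ L) hn)))
      hmK = proj₁ (⊔-ub K L (proj₂ (⊔-ub (M ℕ.⊔ N) (K ℕ.⊔ L) hm)))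
      hnK = proj₁ (⊔-ub K L (proj₂ (⊔-ub (M ℕ.⊔ N) (K ℕ.⊔ L) hn)))
      hmL = proj₂ (⊔-ub K L (proj₂ (⊔-ub (M ℕ.⊔ N) (K ℕ.⊔ L) hm)))
      hnL = proj₂ (⊔-ub K L (proj₂ (⊔-ub (M ℕ.⊔ N) (K ℕ.⊔ L) hn)))
      p = s m * (t m - t′ n) ; q = t′ n * (s m - s′ n)
  in begin
    ∣ s m * t m - s′ n * t′ n ∣
      ≡⟨ cong ∣_∣ (solve 4 (λ a b c d → a :* b :- c :* d := a :* (b :- d) :+ d :* (a :- c)) refl
                    (s m) (t m) (s′ n) (t′ n)) ⟩
    ∣ p + q ∣
      ≤⟨ ∣p+q∣≤∣p∣+∣q∣ p q ⟩
    ∣ p ∣ + ∣ q ∣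
      ≡⟨ cong₂ _+_ (∣p*q∣≡∣p∣*∣q∣ (s m) _) (∣p*q∣≡∣p∣*∣q∣ (t′ n) _) ⟩
    ∣ s m ∣ * ∣ t m - t′ n ∣ + ∣ t′ n ∣ * ∣ s m - s′ n ∣
      ≤⟨ +-mono-≤ (*-mono-≤ (0≤∣p∣ _) (<⇒≤ 0<B) (b m hmM) (g m n hmL hnL))
                  (*-mono-≤ (0≤∣p∣ _) (<⇒≤ 0<C) (c n hnN) (f m n hmK hnK)) ⟩
    B * δ + C * δ
      ≡⟨ trans (sym (*-distribʳ-+ δ B C)) Bδ≡ε ⟩
    ε ∎
  where open ≤-Reasoning

Close-recip : ∀ {s t} → Apart₀ s → Apart₀ t → Close s t →
              Close (λ n → recip (s n)) (λ n → recip (t n))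
Close-recip {s} {t} (δ , 0<δ , M , b) (δ′ , 0<δ′ , N , c) st ε 0<ε = let
  η , 0<η , Dη≡ε = shrink (*-pos (recip-pos 0<δ) (recip-pos 0<δ′)) 0<ε
  K , f = st η 0<η
  in (M ℕ.⊔ N) ℕ.⊔ K , λ m n hm hn →
  let hmM = proj₁ (⊔-ub M N (proj₁ (⊔-ub (M ℕ.⊔ N) K hm)))
      hnN = proj₂ (⊔-ub M N (proj₁ (⊔-ub (M ℕ.⊔ N) K hn)))
      x = s m ; y = t n ; u = recip x ; v = recip y
      δ≤x = b m hmM ; δ≤y = c n hnN
  in begin
    ∣ u - v ∣
      ≡⟨ cong₂ (λ a b → ∣ a - b ∣) (sym (*-identityʳ u)) (sym (*-identityʳ v)) ⟩
    ∣ u * 1ℚ - v * 1ℚ ∣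
      ≡⟨ cong₂ (λ a b → ∣ u * a - v * b ∣) (sym (*-recip (≢0 0<δ′ δ≤y))) (sym (*-recip (≢0 0<δ δ≤x))) ⟩
    ∣ u * (y * v) - v * (x * u) ∣
      ≡⟨ cong ∣_∣ (solve 4 (λ x y u v → u :* (y :* v) :- v :* (x :* u) := u :* v :* (y :- x)) refl x y u v) ⟩
    ∣ u * v * (y - x) ∣
      ≡⟨ trans (∣p*q∣≡∣p∣*∣q∣ (u * v) (y - x)) (cong₂ _*_ (∣p*q∣≡∣p∣*∣q∣ u v) (∣-∣-swap y x)) ⟩
    ∣ u ∣ * ∣ v ∣ * ∣ x - y ∣
      ≤⟨ *-mono-≤ (0≤∣p∣ _) (<⇒≤ (*-pos (recip-pos 0<δ) (recip-pos 0<δ′)))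
           (*-mono-≤ (0≤∣p∣ _) (<⇒≤ (recip-pos 0<δ)) (∣recip∣≤ {q = x} 0<δ δ≤x) (∣recip∣≤ {q = y} 0<δ′ δ≤y))
           (f m n (proj₂ (⊔-ub (M ℕ.⊔ N) K hm)) (proj₂ (⊔-ub (M ℕ.⊔ N) K hn))) ⟩
    recip δ * recip δ′ * η
      ≡⟨ Dη≡ε ⟩
    ε ∎
  where
  open ≤-Reasoning
  ≢0 : ∀ {δ q} → 0ℚ < δ → δ ≤ ∣ q ∣ → q ≢ 0ℚ
  ≢0 0<δ δ≤∣q∣ refl = <-irrefl refl (<-≤-trans 0<δ δ≤∣q∣)

Apart₀-resp : ∀ {s t} → Close s t → Apart₀ t → Apart₀ s
Apart₀-resp {s} {t} st (δ , 0<δ , N , b) = let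
  η , 0<η , η+η≡δ = halve 0<δ
  M , f = st η 0<η
  in η , 0<η , M ℕ.⊔ N , λ n hn →
  let hM = proj₁ (⊔-ub M N hn) ; hN = proj₂ (⊔-ub M N hn)
      x = ∣ s n ∣ ; y = ∣ s n - t n ∣
      y≤η : y ≤ η
      y≤η = f n n hM hM
      η+η≤x+y : η + η ≤ x + y
      η+η≤x+y = ≤-trans (≤-trans (≤-reflexive η+η≡δ) (b n hN))
        (subst (λ z → ∣ z ∣ ≤ x + y)
          (solve 2 (λ a b → a :- (a :- b) := b) refl (s n) (t n))
          (∣p-q∣≤∣p∣+∣q∣ (s n) (s n - t n)))
  in 0≤-⇒≤ (subst (0ℚ ≤_)
       (solve 3 (λ x y e → ((x :+ y) :- (e :+ e)) :+ (e :- y) := x :- e) refl x y η)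
       (+-nonNeg (≤⇒0≤- η+η≤x+y) (≤⇒0≤- y≤η)))

record ℝ : Set where
  constructor real
  field
    seq    : ℕ → ℚ
    cauchy : Close seq seq
open ℝ public

infix  4 _≃ʳ_ _≤ʳ_
infixl 6 _+ʳ_
infixl 7 _*ʳ_

_≃ʳ_ : ℝ → ℝ → Set
x ≃ʳ y = Close (seq x) (seq y)

_≤ʳ_ : ℝ → ℝ → Set
x ≤ʳ y = ∀ ε → 0ℚ < ε → ∃[ N ] (∀ n → N ℕ.≤ n → seq x n ≤ seq y n + ε)

-- Being nonzero, in the positive sense under which a real has a reciprocal.
-- For the denominators that occur in Bounded below, the negative sense
-- ¬ (x ≃ʳ ι 0ℚ) suffices: see Decide.nonvanishing⇒bounded.
_#0 : ℝ → Set
x #0 = Apart₀ (seq x)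

ι : ℚ → ℝ
ι q = real (λ _ → q) (Close-const q)

_+ʳ_ : ℝ → ℝ → ℝ
x +ʳ y = real (λ n → seq x n + seq y n)
              (Close-+ {seq x} {seq x} {seq y} {seq y} (cauchy x) (cauchy y))

_*ʳ_ : ℝ → ℝ → ℝ
x *ʳ y = real (λ n → seq x n * seq y n)
              (Close-* {seq x} {seq x} {seq y} {seq y} (cauchy x) (cauchy y))

_⁻¹ʳ : (x : ℝ) → x #0 → ℝ
(x ⁻¹ʳ) x#0 = real (λ n → recip (seq x n)) (Close-recip {seq x} {seq x} x#0 x#0 (cauchy x))

[-1,1] : ℝ → Set
[-1,1] x = ι (- 1ℚ) ≤ʳ x × x ≤ʳ ι 1ℚ

------------------------------------------------------------------------
-- Quadratic maps and Möbius maps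

-- ⎡ p q ⎤
-- ⎣ r s ⎦
record Matrix : Set where
  constructor mat
  field p q r s : ℚ

-- ⎡ a b c d ⎤
-- ⎣ e f g h ⎦
record Tensor : Set where
  constructor tensor
  field a b c d e f g h : ℚ

infixr 9 _∘ₜ_
infixl 8 _•₁_ _•₂_

_∘ₜ_ : Matrix → Tensor → Tensor
mat p q r s ∘ₜ tensor a b c d e f g h = tensor
  (p * a + q * e) (p * b + q * f) (p * c + q * g) (p * d + q * h)
  (r * a + s * e) (r * b + s * f) (r * c + s * g) (r * d + s * h)

-- ξ(μ(x), y) and ξ(x, μ(y)), with the denominators of μ cleared.
_•₁_ : Tensor → Matrix → Tensor
tensor a b c d e f g h •₁ mat p q r s = tensor
  (a * p + c * r) (b * p + d * r) (a * q + c * s) (b * q + d * s)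
  (e * p + g * r) (f * p + h * r) (e * q + g * s) (f * q + h * s)

_•₂_ : Tensor → Matrix → Tensor
tensor a b c d e f g h •₂ mat p q r s = tensor
  (a * p + b * r) (a * q + b * s) (c * p + d * r) (c * q + d * s)
  (e * p + f * r) (e * q + f * s) (g * p + h * r) (g * q + h * s)

det : Matrix → ℚ
det (mat p q r s) = p * s - q * r

_⁻¹ : (μ : Matrix) .{{_ : NonZero (det μ)}} → Matrix
μ@(mat p q r s) ⁻¹ = mat (δ * s) (δ * - q) (δ * - r) (δ * p)
  where δ = 1/ det μ

numₘ denₘ : Matrix → ℝ → ℝ
numₘ (mat p q r s) x = ι p *ʳ x +ʳ ι q
denₘ (mat p q r s) x = ι r *ʳ x +ʳ ι s

num den : Tensor → ℝ → ℝ → ℝ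
num (tensor a b c d e f g h) x y = ι a *ʳ (x *ʳ y) +ʳ ι b *ʳ x +ʳ ι c *ʳ y +ʳ ι d
den (tensor a b c d e f g h) x y = ι e *ʳ (x *ʳ y) +ʳ ι f *ʳ x +ʳ ι g *ʳ y +ʳ ι h

evalₘ : (μ : Matrix) (x : ℝ) → denₘ μ x #0 → ℝ
evalₘ μ x den#0 = numₘ μ x *ʳ (denₘ μ x ⁻¹ʳ) den#0

eval : (ξ : Tensor) (x y : ℝ) → den ξ x y #0 → ℝ
eval ξ x y den#0 = num ξ x y *ʳ (den ξ x y ⁻¹ʳ) den#0

-- The image μ([-1,1]), as a predicate on ℝ.
Image : Matrix → ℝ → Set
Image μ z = Σ[ x ∈ ℝ ] [-1,1] x × Σ[ den#0 ∈ denₘ μ x #0 ] z ≃ʳ evalₘ μ x den#0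

Bounded : Tensor → Set
Bounded ξ = ∀ x y → [-1,1] x → [-1,1] y → den ξ x y #0

-- ξ([-1,1] × [-1,1]) ⊆ S
MapsInto : (ξ : Tensor) → Bounded ξ → (ℝ → Set) → Set
MapsInto ξ b S = ∀ x y (x∈I : [-1,1] x) (y∈I : [-1,1] y) → S (eval ξ x y (b x y x∈I y∈I))

Refining : Tensor → Set
Refining ξ = Σ[ b ∈ Bounded ξ ] MapsInto ξ b [-1,1]

------------------------------------------------------------------------
-- Digits

data DIG : Set where
  L R M : DIG

⟦_⟧ : DIG → Matrix
⟦ L ⟧ = mat ½   (- ½)
            ½   (ℤ.+ 3 / 2)
⟦ R ⟧ = mat ½     ½
            (- ½) (ℤ.+ 3 / 2)
⟦ M ⟧ = mat 1ℚ 0ℚ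
            0ℚ (ℤ.+ 3 / 1)

det-nonZero : ∀ φ → NonZero (det ⟦ φ ⟧)
det-nonZero L = _
det-nonZero R = _
det-nonZero M = _

⟦_⟧⁻¹ : DIG → Matrix
⟦ φ ⟧⁻¹ = (⟦ φ ⟧ ⁻¹) {{det-nonZero φ}}

record DIGω : Set where
  coinductive
  field
    hd : DIG
    tl : DIGω
open DIGω public

Incl : Tensor → DIG → Set
Incl ξ φ = Σ[ b ∈ Bounded ξ ] MapsInto ξ b (Image ⟦ φ ⟧)

------------------------------------------------------------------------
-- Incl is decidable: it holds iff certain bilinear forms have a common sign
-- at the four corners of the square.

module Decide where

  data Sign : ℚ → Set where
    plus  : Sign 1ℚ
    minus : Sign (- 1ℚ)

  -I-_ : ℚ → Set
  -I- x = - 1ℚ ≤ x × x ≤ 1ℚ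

  -1∈ : -I- (- 1ℚ)
  -1∈ = ≤-dec , ≤-dec

  1∈ : -I- 1ℚ
  1∈ = ≤-dec , ≤-dec

  bil : ℚ → ℚ → ℚ → ℚ → ℚ → ℚ → ℚ
  bil a b c d x y = a * (x * y) + b * x + c * y + d

  numℚ denℚ : Tensor → ℚ → ℚ → ℚ
  numℚ (tensor a b c d e f g h) = bil a b c d
  denℚ (tensor a b c d e f g h) = bil e f g h

  lerp : ℚ → ℚ → ℚ → ℚ
  lerp u v x = ½ * ((1ℚ - x) * u + (1ℚ + x) * v)

  Affine : (ℚ → ℚ) → Set
  Affine f = ∀ x → f x ≡ lerp (f (- 1ℚ)) (f 1ℚ) x

  BiAffine : (ℚ → ℚ → ℚ) → Set
  BiAffine g = (∀ y → Affine (λ x → g x y)) × (∀ x → Affine (g x))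

  Corners : (ℚ → ℚ → Set) → Set
  Corners P = P (- 1ℚ) (- 1ℚ) × P (- 1ℚ) 1ℚ × P 1ℚ (- 1ℚ) × P 1ℚ 1ℚ

  map-Corners : ∀ {P Q : ℚ → ℚ → Set} → (∀ {i j} → -I- i → -I- j → P i j → Q i j) → Corners P → Corners Q
  map-Corners f (a , b , c , d) = f -1∈ -1∈ a , f -1∈ 1∈ b , f 1∈ -1∈ c , f 1∈ 1∈ d

  abstract
    lerp-≥ : ∀ {δ u v x} → δ ≤ u → δ ≤ v → -I- x → δ ≤ lerp u v x
    lerp-≥ {δ} {u} {v} {x} δ≤u δ≤v (-1≤x , x≤1) = 0≤-⇒≤ (subst (0ℚ ≤_)
      (solve 4 (λ δ u v x →
          con ½ :* ((con 1ℚ :- x) :* (u :- δ) :+ (x :- con (- 1ℚ)) :* (v :- δ))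
       := con ½ :* ((con 1ℚ :- x) :* u :+ (con 1ℚ :+ x) :* v) :- δ) refl δ u v x)
      (*-nonNeg (<⇒≤ 0<½) (+-nonNeg (*-nonNeg (≤⇒0≤- x≤1) (≤⇒0≤- δ≤u))
                                    (*-nonNeg (≤⇒0≤- -1≤x) (≤⇒0≤- δ≤v)))))

    affine-≥ : ∀ {f δ x} → Affine f → δ ≤ f (- 1ℚ) → δ ≤ f 1ℚ → -I- x → δ ≤ f x
    affine-≥ {f} {δ} {x} aff h h′ x∈ = subst (δ ≤_) (sym (aff x)) (lerp-≥ h h′ x∈)

    biaffine-≥ : ∀ {g δ x y} → BiAffine g → Corners (λ i j → δ ≤ g i j) → -I- x → -I- y → δ ≤ g x y
    biaffine-≥ {g} {x = x} {y} (affˡ , affʳ) (h₁ , h₂ , h₃ , h₄) x∈ y∈ =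
      affine-≥ {g x} (affʳ x) (affine-≥ {λ x → g x (- 1ℚ)} (affˡ (- 1ℚ)) h₁ h₃ x∈)
                              (affine-≥ {λ x → g x 1ℚ} (affˡ 1ℚ) h₂ h₄ x∈) y∈

    lin-Affine : ∀ α β → Affine (λ x → α * x + β)
    lin-Affine α β x = solve 3 (λ α β x → α :* x :+ β := con ½ :*
      ((con 1ℚ :- x) :* (α :* con (- 1ℚ) :+ β) :+ (con 1ℚ :+ x) :* (α :* con 1ℚ :+ β))) refl α β x

    bil-BiAffine : ∀ a b c d → BiAffine (bil a b c d)
    bil-BiAffine a b c d =
        (λ y x → solve 6 (λ a b c d x y →
          let f x = a :* (x :* y) :+ b :* x :+ c :* y :+ d in
          f x := con ½ :* ((con 1ℚ :- x) :* f (con (- 1ℚ)) :+ (con 1ℚ :+ x) :* f (con 1ℚ))) refl a b c d x y)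
      , (λ x y → solve 6 (λ a b c d x y →
          let f y = a :* (x :* y) :+ b :* x :+ c :* y :+ d in
          f y := con ½ :* ((con 1ℚ :- y) :* f (con (- 1ℚ)) :+ (con 1ℚ :+ y) :* f (con 1ℚ))) refl a b c d x y)

    Affine-* : ∀ {f} σ → Affine f → Affine (λ x → σ * f x)
    Affine-* {f} σ aff x = trans (cong (σ *_) (aff x))
      (solve 4 (λ σ u v x →
          σ :* (con ½ :* ((con 1ℚ :- x) :* u :+ (con 1ℚ :+ x) :* v))
       := con ½ :* ((con 1ℚ :- x) :* (σ :* u) :+ (con 1ℚ :+ x) :* (σ :* v))) refl σ (f (- 1ℚ)) (f 1ℚ) x)

    Affine-+ : ∀ {f g} → Affine f → Affine g → Affine (λ x → f x + g x)
    Affine-+ {f} {g} aff aff′ x = trans (cong₂ _+_ (aff x) (aff′ x))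
      (solve 5 (λ u v u′ v′ x →
          con ½ :* ((con 1ℚ :- x) :* u :+ (con 1ℚ :+ x) :* v)
            :+ con ½ :* ((con 1ℚ :- x) :* u′ :+ (con 1ℚ :+ x) :* v′)
       := con ½ :* ((con 1ℚ :- x) :* (u :+ u′) :+ (con 1ℚ :+ x) :* (v :+ v′))) refl
        (f (- 1ℚ)) (f 1ℚ) (g (- 1ℚ)) (g 1ℚ) x)

    BiAffine-* : ∀ {g} σ → BiAffine g → BiAffine (λ x y → σ * g x y)
    BiAffine-* {g} σ (l , r) = (λ y → Affine-* {λ x → g x y} σ (l y)) , (λ x → Affine-* {g x} σ (r x))

    BiAffine-+ : ∀ {g h} → BiAffine g → BiAffine h → BiAffine (λ x y → g x y + h x y)
    BiAffine-+ {g} {h} (l , r) (l′ , r′) =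
      (λ y → Affine-+ {λ x → g x y} {λ x → h x y} (l y) (l′ y)) , (λ x → Affine-+ {g x} {h x} (r x) (r′ x))

    num-BiAffine : ∀ ξ → BiAffine (numℚ ξ)
    num-BiAffine (tensor a b c d e f g h) = bil-BiAffine a b c d

    den-BiAffine : ∀ ξ → BiAffine (denℚ ξ)
    den-BiAffine (tensor a b c d e f g h) = bil-BiAffine e f g h

    corners-min : ∀ (g : ℚ → ℚ → ℚ) → Corners (λ i j → 0ℚ < g i j) →
                  ∃[ δ ] (0ℚ < δ × Corners (λ i j → δ ≤ g i j))
    corners-min g (h₁ , h₂ , h₃ , h₄) =
        (m₁₂ ⊓ m₃₄) , min-pos (min-pos h₁ h₂) (min-pos h₃ h₄)
      , ≤-trans (p⊓q≤p m₁₂ m₃₄) (p⊓q≤p g₁ g₂) , ≤-trans (p⊓q≤p m₁₂ m₃₄) (p⊓q≤q g₁ g₂)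
      , ≤-trans (p⊓q≤q m₁₂ m₃₄) (p⊓q≤p g₃ g₄) , ≤-trans (p⊓q≤q m₁₂ m₃₄) (p⊓q≤q g₃ g₄)
      where
      g₁ g₂ g₃ g₄ m₁₂ m₃₄ : ℚ
      g₁ = g (- 1ℚ) (- 1ℚ)
      g₂ = g (- 1ℚ) 1ℚ
      g₃ = g 1ℚ (- 1ℚ)
      g₄ = g 1ℚ 1ℚ
      m₁₂ = g₁ ⊓ g₂
      m₃₄ = g₃ ⊓ g₄
      min-pos : ∀ {p q} → 0ℚ < p → 0ℚ < q → 0ℚ < p ⊓ q
      min-pos {p} {q} 0<p 0<q with ≤-total p q
      ... | inj₁ p≤q = subst (0ℚ <_) (sym (p≤q⇒p⊓q≡p p≤q)) 0<p
      ... | inj₂ q≤p = subst (0ℚ <_) (sym (p≥q⇒p⊓q≡q q≤p)) 0<q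

    num-∘ : ∀ μ ξ x y → let open Matrix μ in
            numℚ (μ ∘ₜ ξ) x y ≡ p * numℚ ξ x y + q * denℚ ξ x y
    num-∘ (mat p q r s) (tensor a b c d e f g h) x y = solve 12
      (λ p q a b c d e f g h x y →
           (p :* a :+ q :* e) :* (x :* y) :+ (p :* b :+ q :* f) :* x :+ (p :* c :+ q :* g) :* y :+ (p :* d :+ q :* h)
        := p :* (a :* (x :* y) :+ b :* x :+ c :* y :+ d) :+ q :* (e :* (x :* y) :+ f :* x :+ g :* y :+ h))
      refl p q a b c d e f g h x y

    den-∘ : ∀ μ ξ x y → let open Matrix μ in
            denℚ (μ ∘ₜ ξ) x y ≡ r * numℚ ξ x y + s * denℚ ξ x y
    den-∘ (mat p q r s) ξ@(tensor a b c d e f g h) x y = num-∘ (mat r s p q) ξ x y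

    sign² : ∀ {σ} → Sign σ → σ * σ ≡ 1ℚ
    sign² plus = refl
    sign² minus = refl

    sign-≤ : ∀ {σ} → Sign σ → ∀ q → σ * q ≤ ∣ q ∣
    sign-≤ plus q = ≤-trans (≤-reflexive (*-identityˡ q)) (q≤∣q∣ q)
    sign-≤ minus q = ≤-trans (≤-reflexive (solve 1 (λ q → con (- 1ℚ) :* q := :- q) refl q))
      (≤-trans (q≤∣q∣ (- q)) (≤-reflexive (∣-p∣≡∣p∣ q)))

    sign-pos⇒≢0 : ∀ {σ q} → 0ℚ < σ * q → q ≢ 0ℚ
    sign-pos⇒≢0 {σ} 0<σ*0 refl = <-irrefl (sym (*-zeroʳ σ)) 0<σ*0

    quot-bounds : ∀ {σ n d} → Sign σ → 0ℚ < σ * d → 0ℚ ≤ σ * d + σ * n → 0ℚ ≤ σ * d + - σ * n →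
                  -I- (n * recip d)
    quot-bounds {σ} {n} {d} ±σ 0<σd 0≤+ 0≤- =
        0≤-⇒≤ (subst (0ℚ ≤_) eq₁ (*-nonNeg 0≤+ (<⇒≤ 0<σu)))
      , 0≤-⇒≤ (subst (0ℚ ≤_) eq₂ (*-nonNeg 0≤- (<⇒≤ 0<σu)))
      where
      open ≤-Reasoning
      u : ℚ
      u = recip d
      du≡1 : d * u ≡ 1ℚ
      du≡1 = *-recip (sign-pos⇒≢0 {σ} 0<σd)
      σσdu≡1 : σ * σ * (d * u) ≡ 1ℚ
      σσdu≡1 = trans (cong₂ _*_ (sign² ±σ) du≡1) (*-identityˡ 1ℚ)
      0<σu : 0ℚ < σ * u
      0<σu = *-cancel-pos 0<σd (subst (0ℚ <_)
        (trans (sym σσdu≡1) (solve 3 (λ σ d u → σ :* σ :* (d :* u) := σ :* d :* (σ :* u)) refl σ d u)) 0<1)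
      eq₁ : (σ * d + σ * n) * (σ * u) ≡ n * u - - 1ℚ
      eq₁ = begin-equality
        (σ * d + σ * n) * (σ * u)                ≡⟨ solve 4 (λ σ d n u →
                                                      (σ :* d :+ σ :* n) :* (σ :* u)
                                                   := σ :* σ :* (n :* u) :+ σ :* σ :* (d :* u)) refl σ d n u ⟩
        σ * σ * (n * u) + σ * σ * (d * u)        ≡⟨ cong₂ (λ a b → a * (n * u) + b) (sign² ±σ) σσdu≡1 ⟩
        1ℚ * (n * u) + 1ℚ                        ≡⟨ cong (_+ 1ℚ) (*-identityˡ (n * u)) ⟩
        n * u - - 1ℚ ∎
      eq₂ : (σ * d + - σ * n) * (σ * u) ≡ 1ℚ - n * u
      eq₂ = begin-equality
        (σ * d + - σ * n) * (σ * u)              ≡⟨ solve 4 (λ σ d n u →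
                                                      (σ :* d :+ :- σ :* n) :* (σ :* u)
                                                   := σ :* σ :* (d :* u) :- σ :* σ :* (n :* u)) refl σ d n u ⟩
        σ * σ * (d * u) - σ * σ * (n * u)        ≡⟨ cong₂ (λ a b → a - b * (n * u)) σσdu≡1 (sign² ±σ) ⟩
        1ℚ - 1ℚ * (n * u)                        ≡⟨ cong (λ a → 1ℚ - a) (*-identityˡ (n * u)) ⟩
        1ℚ - n * u ∎

    quot-unique : ∀ {n d k e} → d ≢ 0ℚ → e ≢ 0ℚ → n * d ≡ k * e → n * recip e ≡ k * recip d
    quot-unique {n} {d} {k} {e} d≢0 e≢0 nd≡ke = begin-equality
      n * v                ≡⟨ sym (*-identityʳ (n * v)) ⟩
      n * v * 1ℚ           ≡⟨ cong (n * v *_) (sym (*-recip d≢0)) ⟩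
      n * v * (d * u)      ≡⟨ solve 4 (λ n d u v → n :* v :* (d :* u) := n :* d :* (v :* u)) refl n d u v ⟩
      n * d * (v * u)      ≡⟨ cong (_* (v * u)) nd≡ke ⟩
      k * e * (v * u)      ≡⟨ solve 4 (λ k e u v → k :* e :* (v :* u) := k :* u :* (e :* v)) refl k e u v ⟩
      k * u * (e * v)      ≡⟨ cong (k * u *_) (*-recip e≢0) ⟩
      k * u * 1ℚ           ≡⟨ *-identityʳ (k * u) ⟩
      k * u ∎
      where
      open ≤-Reasoning
      u v : ℚ
      u = recip d
      v = recip e

    -- Real points of [-1,1] are limits of rational ones.

    clamp : ℚ → ℚ
    clamp q = (- 1ℚ) ⊔ (q ⊓ 1ℚ)

    clamp∈ : ∀ q → -I- (clamp q)
    clamp∈ q = p≤p⊔q (- 1ℚ) (q ⊓ 1ℚ) , ⊔-lub (proj₂ -1∈) (p⊓q≤q q 1ℚ)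

    clamp-near : ∀ {q ε} → 0ℚ < ε → - 1ℚ ≤ q + ε → q ≤ 1ℚ + ε → ∣ q - clamp q ∣ ≤ ε
    clamp-near {q} {ε} 0<ε lo hi = ∣q∣≤ q-c≤ε c-q≤ε
      where
      c : ℚ
      c = clamp q
      q≤c+ε : q ≤ c + ε
      q≤c+ε with ≤-total q 1ℚ
      ... | inj₁ q≤1 = ≤-trans
        (≤-trans (≤-reflexive (sym (p≤q⇒p⊓q≡p q≤1))) (p≤q⊔p (- 1ℚ) (q ⊓ 1ℚ)))
        (≤-trans (≤-reflexive (sym (+-identityʳ c))) (+-monoʳ-≤ c (<⇒≤ 0<ε)))
      ... | inj₂ 1≤q = ≤-trans hi (+-monoˡ-≤ ε
        (≤-trans (≤-reflexive (sym (p≥q⇒p⊓q≡q 1≤q))) (p≤q⊔p (- 1ℚ) (q ⊓ 1ℚ))))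
      c≤q+ε : c ≤ q + ε
      c≤q+ε = ⊔-lub lo (≤-trans (p⊓q≤p q 1ℚ)
        (≤-trans (≤-reflexive (sym (+-identityʳ q))) (+-monoʳ-≤ q (<⇒≤ 0<ε))))
      q-c≤ε : q - c ≤ ε
      q-c≤ε = 0≤-⇒≤ (subst (0ℚ ≤_)
        (solve 3 (λ q c ε → c :+ ε :- q := ε :- (q :- c)) refl q c ε) (≤⇒0≤- q≤c+ε))
      c-q≤ε : - (q - c) ≤ ε
      c-q≤ε = 0≤-⇒≤ (subst (0ℚ ≤_)
        (solve 3 (λ q c ε → q :+ ε :- c := ε :- :- (q :- c)) refl q c ε) (≤⇒0≤- c≤q+ε))

    Close-clamp : ∀ {x} → [-1,1] x → Close (seq x) (λ n → clamp (seq x n))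
    Close-clamp {x} (lo , hi) ε 0<ε = let
      δ , 0<δ , δ+δ≡ε = halve 0<ε
      K , f = lo δ 0<δ
      J , g = hi δ 0<δ
      N , h = cauchy x δ 0<δ
      in (K ℕ.⊔ J) ℕ.⊔ N , λ m n hm hn → let
        KJ≤n = proj₁ (⊔-ub (K ℕ.⊔ J) N hn)
      in ≤-trans (∣-∣-triangle (seq x m) (seq x n) (clamp (seq x n)))
        (≤-trans (+-mono-≤
          (h m n (proj₂ (⊔-ub (K ℕ.⊔ J) N hm)) (proj₂ (⊔-ub (K ℕ.⊔ J) N hn)))
          (clamp-near {seq x n} 0<δ (f n (proj₁ (⊔-ub K J KJ≤n))) (g n (proj₂ (⊔-ub K J KJ≤n)))))
        (≤-reflexive δ+δ≡ε))

    ptwise∈ : ∀ {x} → (∀ n → -I- (seq x n)) → [-1,1] x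
    ptwise∈ {x} h =
        (λ ε 0<ε → 0 , λ n _ → ≤-trans (proj₁ (h n))
          (≤-trans (≤-reflexive (sym (+-identityʳ (seq x n)))) (+-monoʳ-≤ (seq x n) (<⇒≤ 0<ε))))
      , (λ ε 0<ε → 0 , λ n _ → ≤-trans (proj₂ (h n))
          (≤-trans (≤-reflexive (sym (+-identityʳ 1ℚ))) (+-monoʳ-≤ 1ℚ (<⇒≤ 0<ε))))

    Close-≗ : ∀ {s t u} → Close s t → (∀ n → t n ≡ u n) → Close s u
    Close-≗ {s} st t≗u ε 0<ε = let N , h = st ε 0<ε in
      N , λ m n hm hn → subst (λ z → ∣ s m - z ∣ ≤ ε) (t≗u n) (h m n hm hn)

    Close-refl′ : ∀ {s t} → Close s t → Close t t
    Close-refl′ {s} {t} st = Close-trans {t} {s} {t} (Close-sym {s} {t} st) st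

    Close-lin : ∀ α β {s t} → Close s t → Close (λ n → α * s n + β) (λ n → α * t n + β)
    Close-lin α β {s} {t} st = Close-+ {λ n → α * s n} {λ n → α * t n} {λ _ → β} {λ _ → β}
      (Close-* {λ _ → α} {λ _ → α} {s} {t} (Close-const α) st) (Close-const β)

    Close-bil : ∀ a b c d {s s′ t t′} → Close s s′ → Close t t′ →
                Close (λ n → bil a b c d (s n) (t n)) (λ n → bil a b c d (s′ n) (t′ n))
    Close-bil a b c d {s} {s′} {t} {t′} ss tt =
      Close-+ {λ n → a * (s n * t n) + b * s n + c * t n} {λ n → a * (s′ n * t′ n) + b * s′ n + c * t′ n} {λ _ → d} {λ _ → d}
      (Close-+ {λ n → a * (s n * t n) + b * s n} {λ n → a * (s′ n * t′ n) + b * s′ n} {λ n → c * t n} {λ n → c * t′ n}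
      (Close-+ {λ n → a * (s n * t n)} {λ n → a * (s′ n * t′ n)} {λ n → b * s n} {λ n → b * s′ n}
        (Close-* {λ _ → a} {λ _ → a} {λ n → s n * t n} {λ n → s′ n * t′ n} (Close-const a)
          (Close-* {s} {s′} {t} {t′} ss tt))
        (Close-* {λ _ → b} {λ _ → b} {s} {s′} (Close-const b) ss))
        (Close-* {λ _ → c} {λ _ → c} {t} {t′} (Close-const c) tt))
        (Close-const d)

    Close-num : ∀ ξ {x y s t} → Close (seq x) s → Close (seq y) t →
                Close (seq (num ξ x y)) (λ n → numℚ ξ (s n) (t n))
    Close-num (tensor a b c d e f g h) {x} {y} {s} {t} = Close-bil a b c d {seq x} {s} {seq y} {t}

    Close-den : ∀ ξ {x y s t} → Close (seq x) s → Close (seq y) t →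
                Close (seq (den ξ x y)) (λ n → denℚ ξ (s n) (t n))
    Close-den (tensor a b c d e f g h) {x} {y} {s} {t} = Close-bil e f g h {seq x} {s} {seq y} {t}

    Close-≥0 : ∀ {q t} → Close (λ _ → q) t → (∀ n → 0ℚ ≤ t n) → 0ℚ ≤ q
    Close-≥0 {q} {t} qt h = ≮⇒≥ λ q<0 → let
      ε , 0<ε , 2ε≡-q = halve (neg-antimono-< q<0)
      N , near = qt ε 0<ε
      tN-q≤ε : t N - q ≤ ε
      tN-q≤ε = ≤-trans (q≤∣q∣ (t N - q))
        (≤-trans (≤-reflexive (∣-∣-swap (t N) q)) (near N N ℕ.≤-refl ℕ.≤-refl))
      2ε≤ε : ε + ε ≤ ε
      2ε≤ε = ≤-trans (≤-trans (≤-reflexive 2ε≡-q) (≤-trans (≤-reflexive (sym (+-identityˡ (- q))))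
               (+-monoˡ-≤ (- q) (h N)))) tN-q≤ε
      in <-irrefl refl (<-≤-trans 0<ε (0≤-⇒≤ (subst (0ℚ ≤_)
           (solve 1 (λ ε → ε :- (ε :+ ε) := con 0ℚ :- ε) refl ε) (≤⇒0≤- 2ε≤ε))))

  record Facts (φ : DIG) : Set where
    open Matrix ⟦ φ ⟧ public
    δ : ℚ
    δ = (1/ det ⟦ φ ⟧) {{det-nonZero φ}}
    -- α , β range over the rational linear forms tested on a value z of ⟦ φ ⟧.
    NonNegOn : ℚ → ℚ → Set
    NonNegOn α β = 0ℚ ≤ α * (p * - 1ℚ + q) + β * (r * - 1ℚ + s) × 0ℚ ≤ α * (p * 1ℚ + q) + β * (r * 1ℚ + s)
    field
      0<δ   : 0ℚ < δ
      den₋  : 1ℚ ≤ r * - 1ℚ + s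
      den₊  : 1ℚ ≤ r * 1ℚ + s
      test₀ : NonNegOn (- r) (p - ½)
      test₊ : NonNegOn (s - r) (p - q)
      test₋ : NonNegOn (- (r + s)) (p + q)

  facts : ∀ φ → Facts φ
  facts L = record
    { 0<δ = <-dec ; den₋ = ≤-dec ; den₊ = ≤-dec
    ; test₀ = ≤-dec , ≤-dec
    ; test₊ = ≤-dec , ≤-dec
    ; test₋ = ≤-dec , ≤-dec }
  facts R = record
    { 0<δ = <-dec ; den₋ = ≤-dec ; den₊ = ≤-dec
    ; test₀ = ≤-dec , ≤-dec
    ; test₊ = ≤-dec , ≤-dec
    ; test₋ = ≤-dec , ≤-dec }
  facts M = record
    { 0<δ = <-dec ; den₋ = ≤-dec ; den₊ = ≤-dec
    ; test₀ = ≤-dec , ≤-dec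
    ; test₊ = ≤-dec , ≤-dec
    ; test₋ = ≤-dec , ≤-dec }

  -- σ is the common sign of the denominators of ξ and of φ⁻¹ ∘ ξ at the four
  -- corners, where moreover φ⁻¹ ∘ ξ takes values in [-1,1].
  CornerTest : ℚ → Tensor → DIG → ℚ → ℚ → Set
  CornerTest σ ξ φ i j =
    0ℚ < σ * denℚ ξ i j ×
    0ℚ < σ * denℚ (⟦ φ ⟧⁻¹ ∘ₜ ξ) i j ×
    0ℚ ≤ σ * denℚ (⟦ φ ⟧⁻¹ ∘ₜ ξ) i j + σ * numℚ (⟦ φ ⟧⁻¹ ∘ₜ ξ) i j ×
    0ℚ ≤ σ * denℚ (⟦ φ ⟧⁻¹ ∘ₜ ξ) i j + - σ * numℚ (⟦ φ ⟧⁻¹ ∘ₜ ξ) i j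

  Criterion : ℚ → Tensor → DIG → Set
  Criterion σ ξ φ = Corners (CornerTest σ ξ φ)

  Criterion? : ∀ σ ξ φ → Dec (Criterion σ ξ φ)
  Criterion? σ ξ φ = at (- 1ℚ) (- 1ℚ) ×-dec at (- 1ℚ) 1ℚ ×-dec at 1ℚ (- 1ℚ) ×-dec at 1ℚ 1ℚ
    where
    ξ′ : Tensor
    ξ′ = ⟦ φ ⟧⁻¹ ∘ₜ ξ
    at : ∀ i j → Dec (CornerTest σ ξ φ i j)
    at i j = (0ℚ <? σ * denℚ ξ i j)
       ×-dec (0ℚ <? σ * denℚ ξ′ i j)
       ×-dec (0ℚ ≤? σ * denℚ ξ′ i j + σ * numℚ ξ′ i j)
       ×-dec (0ℚ ≤? σ * denℚ ξ′ i j + - σ * numℚ ξ′ i j)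

  biaffine-pos : ∀ g → BiAffine g → Corners (λ i j → 0ℚ < g i j) →
                 ∃[ δ ] (0ℚ < δ × (∀ {x y} → -I- x → -I- y → δ ≤ g x y))
  biaffine-pos g bi cs = let δ , 0<δ , h = corners-min g cs in
    δ , 0<δ , λ x∈ y∈ → biaffine-≥ {g} {δ} bi h x∈ y∈

  corners⇒bounded : ∀ {σ} ξ → Sign σ → Corners (λ i j → 0ℚ < σ * denℚ ξ i j) → Bounded ξ
  corners⇒bounded {σ} ξ ±σ cs x y x∈ y∈ = let
    x̂ = λ n → clamp (seq x n)
    ŷ = λ n → clamp (seq y n)
    η , 0<η , h = biaffine-pos (λ i j → σ * denℚ ξ i j) (BiAffine-* {denℚ ξ} σ (den-BiAffine ξ)) cs
    in Apart₀-resp {seq (den ξ x y)} {λ n → denℚ ξ (x̂ n) (ŷ n)}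
         (Close-den ξ {x} {y} {x̂} {ŷ} (Close-clamp {x} x∈) (Close-clamp {y} y∈))
         (η , 0<η , 0 , λ n _ → ≤-trans (h {x̂ n} {ŷ n} (clamp∈ (seq x n)) (clamp∈ (seq y n)))
                                        (sign-≤ ±σ (denℚ ξ (x̂ n) (ŷ n))))

  sufficient : ∀ {σ} ξ φ → Sign σ → Criterion σ ξ φ → Incl ξ φ
  sufficient {σ} ξ φ ±σ crit = (λ x y x∈ y∈ → At.den#0 x y x∈ y∈)
                                  , (λ x y x∈ y∈ → At.w x y x∈ y∈ , At.w∈ x y x∈ y∈ , At.denₘ#0 x y x∈ y∈ , At.z≃φw x y x∈ y∈)
    where
    open Facts (facts φ)
    ξ′ : Tensor
    ξ′ = ⟦ φ ⟧⁻¹ ∘ₜ ξ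
    crit₁ : Corners (λ i j → 0ℚ < σ * denℚ ξ i j)
    crit₁ = map-Corners {CornerTest σ ξ φ} (λ _ _ h → proj₁ h) crit
    crit₂ : Corners (λ i j → 0ℚ < σ * denℚ ξ′ i j)
    crit₂ = map-Corners {CornerTest σ ξ φ} (λ _ _ h → proj₁ (proj₂ h)) crit
    crit₃ : Corners (λ i j → 0ℚ ≤ σ * denℚ ξ′ i j + σ * numℚ ξ′ i j)
    crit₃ = map-Corners {CornerTest σ ξ φ} (λ _ _ h → proj₁ (proj₂ (proj₂ h))) crit
    crit₄ : Corners (λ i j → 0ℚ ≤ σ * denℚ ξ′ i j + - σ * numℚ ξ′ i j)
    crit₄ = map-Corners {CornerTest σ ξ φ} (λ _ _ h → proj₂ (proj₂ (proj₂ h))) crit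
    module At (x y : ℝ) (x∈ : [-1,1] x) (y∈ : [-1,1] y) where
      x̂ ŷ D D′ N N′ : ℕ → ℚ
      x̂ n = clamp (seq x n)
      ŷ n = clamp (seq y n)
      D n = denℚ ξ (x̂ n) (ŷ n)
      N n = numℚ ξ (x̂ n) (ŷ n)
      D′ n = denℚ ξ′ (x̂ n) (ŷ n)
      N′ n = numℚ ξ′ (x̂ n) (ŷ n)

      x̂∈ : ∀ n → -I- (x̂ n)
      x̂∈ n = clamp∈ (seq x n)
      ŷ∈ : ∀ n → -I- (ŷ n)
      ŷ∈ n = clamp∈ (seq y n)
      x≈ : Close (seq x) x̂
      x≈ = Close-clamp {x} x∈
      y≈ : Close (seq y) ŷ
      y≈ = Close-clamp {y} y∈
      x̂≈ : Close x̂ x̂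
      x̂≈ = Close-refl′ {seq x} {x̂} x≈
      ŷ≈ : Close ŷ ŷ
      ŷ≈ = Close-refl′ {seq y} {ŷ} y≈

      denominator-pos : ∀ ζ → Corners (λ i j → 0ℚ < σ * denℚ ζ i j) →
                        ∃[ η ] (0ℚ < η × (∀ n → η ≤ σ * denℚ ζ (x̂ n) (ŷ n)))
      denominator-pos ζ cs = let
        η , 0<η , h = biaffine-pos (λ i j → σ * denℚ ζ i j) (BiAffine-* {denℚ ζ} σ (den-BiAffine ζ)) cs
        in η , 0<η , λ n → h {x̂ n} {ŷ n} (x̂∈ n) (ŷ∈ n)

      apart : ∀ ζ → Corners (λ i j → 0ℚ < σ * denℚ ζ i j) → Apart₀ (λ n → denℚ ζ (x̂ n) (ŷ n))
      apart ζ cs = let η , 0<η , h = denominator-pos ζ cs in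
        η , 0<η , 0 , λ n _ → ≤-trans (h n) (sign-≤ ±σ (denℚ ζ (x̂ n) (ŷ n)))

      σD>0 : ∀ n → 0ℚ < σ * D n
      σD>0 n = let η , 0<η , h = denominator-pos ξ crit₁ in <-≤-trans 0<η (h n)
      σD′>0 : ∀ n → 0ℚ < σ * D′ n
      σD′>0 n = let η , 0<η , h = denominator-pos ξ′ crit₂ in <-≤-trans 0<η (h n)

      D#0 : Apart₀ D
      D#0 = apart ξ crit₁
      D′#0 : Apart₀ D′
      D′#0 = apart ξ′ crit₂

      den≈ : Close (seq (den ξ x y)) D
      den≈ = Close-den ξ {x} {y} {x̂} {ŷ} x≈ y≈
      num≈ : Close (seq (num ξ x y)) N
      num≈ = Close-num ξ {x} {y} {x̂} {ŷ} x≈ y≈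

      den#0 : den ξ x y #0
      den#0 = corners⇒bounded ξ ±σ crit₁ x y x∈ y∈

      N′≈ : Close N′ N′
      N′≈ = Close-sym {N′} {N′} (Close-bil (a ξ′) (b ξ′) (c ξ′) (d ξ′) {x̂} {x̂} {ŷ} {ŷ} x̂≈ ŷ≈)
        where open Tensor
      D′≈ : Close D′ D′
      D′≈ = Close-bil (e ξ′) (f ξ′) (g ξ′) (h ξ′) {x̂} {x̂} {ŷ} {ŷ} x̂≈ ŷ≈
        where open Tensor

      w : ℝ
      w = real (λ n → N′ n * recip (D′ n))
        (Close-* {N′} {N′} {λ n → recip (D′ n)} {λ n → recip (D′ n)} N′≈
          (Close-recip {D′} {D′} D′#0 D′#0 D′≈))

      bound : ∀ τ → Corners (λ i j → 0ℚ ≤ σ * denℚ ξ′ i j + τ * numℚ ξ′ i j) →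
              ∀ n → 0ℚ ≤ σ * D′ n + τ * N′ n
      bound τ cs n = biaffine-≥ {λ i j → σ * denℚ ξ′ i j + τ * numℚ ξ′ i j}
        (BiAffine-+ {λ i j → σ * denℚ ξ′ i j} {λ i j → τ * numℚ ξ′ i j}
          (BiAffine-* {denℚ ξ′} σ (den-BiAffine ξ′)) (BiAffine-* {numℚ ξ′} τ (num-BiAffine ξ′)))
        cs (x̂∈ n) (ŷ∈ n)

      wₙ∈ : ∀ n → -I- (seq w n)
      wₙ∈ n = quot-bounds {σ} {N′ n} {D′ n} ±σ (σD′>0 n)
        (bound σ crit₃ n)
        (bound (- σ) crit₄ n)

      w∈ : [-1,1] w
      w∈ = ptwise∈ {w} wₙ∈

      denₘ≥1 : ∀ n → 1ℚ ≤ r * seq w n + s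
      denₘ≥1 n = affine-≥ {λ x → r * x + s} (lin-Affine r s) den₋ den₊ (wₙ∈ n)

      denₘ#0 : denₘ ⟦ φ ⟧ w #0
      denₘ#0 = 1ℚ , 0<1 , 0 , λ n _ → ≤-trans (denₘ≥1 n) (q≤∣q∣ (r * seq w n + s))

      δdet≡1 : δ * (p * s - q * r) ≡ 1ℚ
      δdet≡1 = *-inverseˡ (det ⟦ φ ⟧) {{det-nonZero φ}}

      values : ∀ n → N n * recip (D n) ≡ (p * seq w n + q) * recip (r * seq w n + s)
      values n = sym (quot-unique {p * v + q} {D n} {N n} {r * v + s} D≢0
          (<⇒≢0 (<-≤-trans 0<1 (denₘ≥1 n))) eq)
        where
        open ≤-Reasoning
        v u : ℚ
        v = seq w n
        u = recip (D′ n)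
        D′≢0 : D′ n ≢ 0ℚ
        D′≢0 = sign-pos⇒≢0 {σ} (σD′>0 n)
        D≢0 : D n ≢ 0ℚ
        D≢0 = sign-pos⇒≢0 {σ} (σD>0 n)
        N′≡ : D′ n * v ≡ N′ n
        N′≡ = begin-equality
          D′ n * (N′ n * u)     ≡⟨ solve 3 (λ d n u → d :* (n :* u) := n :* (d :* u)) refl (D′ n) (N′ n) u ⟩
          N′ n * (D′ n * u)     ≡⟨ cong (N′ n *_) (*-recip D′≢0) ⟩
          N′ n * 1ℚ             ≡⟨ *-identityʳ (N′ n) ⟩
          N′ n ∎
        N≡ : N n ≡ p * N′ n + q * D′ n
        N≡ = begin-equality
          N n                                   ≡⟨ sym (*-identityˡ (N n)) ⟩
          1ℚ * N n                              ≡⟨ cong (_* N n) (sym δdet≡1) ⟩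
          δ * (p * s - q * r) * N n             ≡⟨ solve 7 (λ δ p q r s N D →
              δ :* (p :* s :- q :* r) :* N
           := p :* (δ :* s :* N :+ δ :* :- q :* D) :+ q :* (δ :* :- r :* N :+ δ :* p :* D))
              refl δ p q r s (N n) (D n) ⟩
          p * (δ * s * N n + δ * - q * D n) + q * (δ * - r * N n + δ * p * D n)
                                                ≡⟨ sym (cong₂ (λ a b → p * a + q * b)
                                                     (num-∘ ⟦ φ ⟧⁻¹ ξ (x̂ n) (ŷ n)) (den-∘ ⟦ φ ⟧⁻¹ ξ (x̂ n) (ŷ n))) ⟩
          p * N′ n + q * D′ n ∎
        D≡ : D n ≡ r * N′ n + s * D′ n
        D≡ = begin-equality
          D n                                   ≡⟨ sym (*-identityˡ (D n)) ⟩
          1ℚ * D n                              ≡⟨ cong (_* D n) (sym δdet≡1) ⟩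
          δ * (p * s - q * r) * D n             ≡⟨ solve 7 (λ δ p q r s N D →
              δ :* (p :* s :- q :* r) :* D
           := r :* (δ :* s :* N :+ δ :* :- q :* D) :+ s :* (δ :* :- r :* N :+ δ :* p :* D))
              refl δ p q r s (N n) (D n) ⟩
          r * (δ * s * N n + δ * - q * D n) + s * (δ * - r * N n + δ * p * D n)
                                                ≡⟨ sym (cong₂ (λ a b → r * a + s * b)
                                                     (num-∘ ⟦ φ ⟧⁻¹ ξ (x̂ n) (ŷ n)) (den-∘ ⟦ φ ⟧⁻¹ ξ (x̂ n) (ŷ n))) ⟩
          r * N′ n + s * D′ n ∎
        eq : (p * v + q) * D n ≡ N n * (r * v + s)
        eq = begin-equality
          (p * v + q) * D n                           ≡⟨ cong ((p * v + q) *_) D≡ ⟩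
          (p * v + q) * (r * N′ n + s * D′ n)         ≡⟨ cong (λ a → (p * v + q) * (r * a + s * D′ n)) (sym N′≡) ⟩
          (p * v + q) * (r * (D′ n * v) + s * D′ n)   ≡⟨ solve 6 (λ p q r s v d →
              (p :* v :+ q) :* (r :* (d :* v) :+ s :* d) := (p :* (d :* v) :+ q :* d) :* (r :* v :+ s))
              refl p q r s v (D′ n) ⟩
          (p * (D′ n * v) + q * D′ n) * (r * v + s)   ≡⟨ cong (λ a → (p * a + q * D′ n) * (r * v + s)) N′≡ ⟩
          (p * N′ n + q * D′ n) * (r * v + s)         ≡⟨ cong (_* (r * v + s)) (sym N≡) ⟩
          N n * (r * v + s) ∎

      z≃φw : eval ξ x y den#0 ≃ʳ evalₘ ⟦ φ ⟧ w denₘ#0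
      z≃φw = Close-≗ {seq (eval ξ x y den#0)} {λ n → N n * recip (D n)}
        (Close-* {seq (num ξ x y)} {N} {λ n → recip (seq (den ξ x y) n)} {λ n → recip (D n)} num≈
          (Close-recip {seq (den ξ x y)} {D} den#0 D#0 den≈)) values

  affine-no-zero : ∀ f → Affine f → (∀ x → -I- x → f x ≢ 0ℚ) → 0ℚ < f (- 1ℚ) → 0ℚ < f 1ℚ
  affine-no-zero f aff ≢0 0<u with <-cmp 0ℚ (f 1ℚ)
  ... | tri< 0<v _ _ = 0<v
  ... | tri≈ _ 0≡v _ = contradiction (sym 0≡v) (≢0 1ℚ 1∈)
  ... | tri> _ _ v<0 = contradiction (trans (aff x₀) lerp≡0) (≢0 x₀ x₀∈)
    where
    open ≤-Reasoning
    u v t x₀ : ℚ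
    u = f (- 1ℚ)
    v = f 1ℚ
    0<u-v : 0ℚ < u - v
    0<u-v = +-pos 0<u (neg-antimono-< v<0)
    t = recip (u - v)
    x₀ = (u + v) * t
    inv : (u - v) * t ≡ 1ℚ
    inv = *-recip (<⇒≢0 0<u-v)
    0≤t : 0ℚ ≤ t
    0≤t = <⇒≤ (recip-pos 0<u-v)
    0≤-v : 0ℚ ≤ - v
    0≤-v = <⇒≤ (neg-antimono-< v<0)
    eq₁ : (u + u) * t ≡ x₀ - - 1ℚ
    eq₁ = trans (solve 3 (λ u v t → (u :+ u) :* t := (u :+ v) :* t :+ (u :- v) :* t) refl u v t)
      (cong (x₀ +_) inv)
    eq₂ : (- v + - v) * t ≡ 1ℚ - x₀
    eq₂ = trans (solve 3 (λ u v t → (:- v :+ :- v) :* t := (u :- v) :* t :- (u :+ v) :* t) refl u v t)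
      (cong (_- x₀) inv)
    x₀∈ : -I- x₀
    x₀∈ = 0≤-⇒≤ (subst (0ℚ ≤_) eq₁ (*-nonNeg (+-nonNeg (<⇒≤ 0<u) (<⇒≤ 0<u)) 0≤t))
        , 0≤-⇒≤ (subst (0ℚ ≤_) eq₂ (*-nonNeg (+-nonNeg 0≤-v 0≤-v) 0≤t))
    lerp≡0 : lerp u v x₀ ≡ 0ℚ
    lerp≡0 = begin-equality
      lerp u v x₀
        ≡⟨ solve 3 (λ u v t →
              con ½ :* ((con 1ℚ :- (u :+ v) :* t) :* u :+ (con 1ℚ :+ (u :+ v) :* t) :* v)
           := con ½ :* (u :+ v) :* (con 1ℚ :- (u :- v) :* t)) refl u v t ⟩
      ½ * (u + v) * (1ℚ - (u - v) * t)
        ≡⟨ cong (λ a → ½ * (u + v) * (1ℚ - a)) inv ⟩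
      ½ * (u + v) * 0ℚ
        ≡⟨ *-zeroʳ (½ * (u + v)) ⟩
      0ℚ ∎

  biaffine-sign : ∀ g → BiAffine g → (∀ x y → -I- x → -I- y → g x y ≢ 0ℚ) →
                  0ℚ < g (- 1ℚ) (- 1ℚ) → Corners (λ i j → 0ℚ < g i j)
  biaffine-sign g (l , r) ≢0 h =
      h
    , affine-no-zero (g (- 1ℚ)) (r (- 1ℚ)) (λ y y∈ → ≢0 (- 1ℚ) y -1∈ y∈) h
    , h₃
    , affine-no-zero (g 1ℚ) (r 1ℚ) (λ y y∈ → ≢0 1ℚ y 1∈ y∈) h₃
    where
    h₃ : 0ℚ < g 1ℚ (- 1ℚ)
    h₃ = affine-no-zero (λ x → g x (- 1ℚ)) (l (- 1ℚ)) (λ x x∈ → ≢0 x (- 1ℚ) x∈ -1∈) h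

  ι∈ : ∀ {q} → -I- q → [-1,1] (ι q)
  ι∈ {q} q∈ = ptwise∈ {ι q} (λ _ → q∈)

  bounded-≢0 : ∀ ξ → Bounded ξ → ∀ x y → -I- x → -I- y → denℚ ξ x y ≢ 0ℚ
  bounded-≢0 (tensor a b c d e f g h) bd x y x∈ y∈ D≡0 = let
    δ , 0<δ , N , δ≤ = bd (ι x) (ι y) (ι∈ x∈) (ι∈ y∈)
    in <-irrefl refl (<-≤-trans 0<δ (subst (λ z → δ ≤ ∣ z ∣) D≡0 (δ≤ N ℕ.≤-refl)))

  common-sign : ∀ ξ → (∀ x y → -I- x → -I- y → denℚ ξ x y ≢ 0ℚ) →
                ∃[ σ ] (Sign σ × Corners (λ i j → 0ℚ < σ * denℚ ξ i j))
  common-sign ξ ≢0 with <-cmp 0ℚ (denℚ ξ (- 1ℚ) (- 1ℚ))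
  ... | tri≈ _ 0≡D _ = contradiction (sym 0≡D) (≢0 (- 1ℚ) (- 1ℚ) -1∈ -1∈)
  ... | tri< 0<D _ _ = 1ℚ , plus ,
      map-Corners {λ i j → 0ℚ < denℚ ξ i j} {λ i j → 0ℚ < 1ℚ * denℚ ξ i j}
        (λ {i} {j} _ _ → subst (0ℚ <_) (sym (*-identityˡ (denℚ ξ i j))))
        (biaffine-sign (denℚ ξ) (den-BiAffine ξ) ≢0 0<D)
  ... | tri> _ _ D<0 = - 1ℚ , minus , biaffine-sign (λ x y → - 1ℚ * denℚ ξ x y)
      (BiAffine-* {denℚ ξ} (- 1ℚ) (den-BiAffine ξ))
      (λ x y x∈ y∈ -D≡0 → ≢0 x y x∈ y∈ (trans (neg² (denℚ ξ x y)) (cong (- 1ℚ *_) -D≡0)))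
      (subst (0ℚ <_) (solve 1 (λ q → :- q := con (- 1ℚ) :* q) refl (denℚ ξ (- 1ℚ) (- 1ℚ))) (neg-antimono-< D<0))
    where
    neg² : ∀ q → q ≡ - 1ℚ * (- 1ℚ * q)
    neg² = solve 1 (λ q → q := con (- 1ℚ) :* (con (- 1ℚ) :* q)) refl

  nonvanishing⇒bounded : ∀ ξ → (∀ x y → [-1,1] x → [-1,1] y → ¬ (den ξ x y ≃ʳ ι 0ℚ)) → Bounded ξ
  nonvanishing⇒bounded ξ@(tensor a b c d e f g h) ≄0 = let
    σ , ±σ , cs = common-sign ξ λ x y x∈ y∈ D≡0 →
      ≄0 (ι x) (ι y) (ι∈ x∈) (ι∈ y∈)
        (subst (λ q → Close (λ _ → denℚ ξ x y) (λ _ → q)) D≡0 (Close-const (denℚ ξ x y)))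
    in corners⇒bounded ξ ±σ cs

  -- A rational value z of ⟦ φ ⟧ at a real point of [-1,1] passes every test.
  image-test : ∀ φ z → Image ⟦ φ ⟧ (ι z) → ∀ α β → Facts.NonNegOn (facts φ) α β → 0ℚ ≤ α * z + β
  image-test φ z (w , w∈ , den#0 , z≃) α β (t₋ , t₊) = Close-≥0 {α * z + β} {λ n → α * v n + β}
      (Close-lin α β {λ _ → z} {v} z≈v) test
    where
    open Facts (facts φ)
    open ≤-Reasoning
    ŵ e v : ℕ → ℚ
    ŵ n = clamp (seq w n)
    e n = r * ŵ n + s
    v n = (p * ŵ n + q) * recip (e n)
    w≈ : Close (seq w) ŵ
    w≈ = Close-clamp {w} w∈
    1≤e : ∀ n → 1ℚ ≤ e n
    1≤e n = affine-≥ {λ x → r * x + s} (lin-Affine r s) den₋ den₊ (clamp∈ (seq w n))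
    e#0 : Apart₀ e
    e#0 = 1ℚ , 0<1 , 0 , λ n _ → ≤-trans (1≤e n) (q≤∣q∣ (e n))
    z≈v : Close (λ _ → z) v
    z≈v = Close-trans {λ _ → z} {seq (evalₘ ⟦ φ ⟧ w den#0)} {v} z≃
      (Close-* {λ n → p * seq w n + q} {λ n → p * ŵ n + q}
               {λ n → recip (r * seq w n + s)} {λ n → recip (e n)}
        (Close-lin p q {seq w} {ŵ} w≈)
        (Close-recip {λ n → r * seq w n + s} {e} den#0 e#0 (Close-lin r s {seq w} {ŵ} w≈)))
    form : ℚ → ℚ
    form x = α * (p * x + q) + β * (r * x + s)
    form-Affine : Affine form
    form-Affine = Affine-+ {λ x → α * (p * x + q)} {λ x → β * (r * x + s)}
      (Affine-* {λ x → p * x + q} α (lin-Affine p q)) (Affine-* {λ x → r * x + s} β (lin-Affine r s))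
    test : ∀ n → 0ℚ ≤ α * v n + β
    test n = subst (0ℚ ≤_) eq
      (*-nonNeg (affine-≥ {form} form-Affine t₋ t₊ (clamp∈ (seq w n))) (<⇒≤ (recip-pos 0<e)))
      where
      0<e : 0ℚ < e n
      0<e = <-≤-trans 0<1 (1≤e n)
      k u : ℚ
      k = p * ŵ n + q
      u = recip (e n)
      eq : (α * k + β * e n) * u ≡ α * (k * u) + β
      eq = begin-equality
        (α * k + β * e n) * u        ≡⟨ solve 5 (λ α β k e u → (α :* k :+ β :* e) :* u := α :* (k :* u) :+ β :* (e :* u))
                                          refl α β k (e n) u ⟩
        α * (k * u) + β * (e n * u)  ≡⟨ cong (λ a → α * (k * u) + β * a) (*-recip (<⇒≢0 0<e)) ⟩
        α * (k * u) + β * 1ℚ         ≡⟨ cong (α * (k * u) +_) (*-identityʳ β) ⟩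
        α * (k * u) + β ∎

  necessary : ∀ ξ φ → Incl ξ φ → ∃[ σ ] (Sign σ × Criterion σ ξ φ)
  necessary ξ φ (bd , into) = let σ , ±σ , cs = common-sign ξ (bounded-≢0 ξ bd) in
      σ , ±σ , map-Corners {λ i j → 0ℚ < σ * denℚ ξ i j} {CornerTest σ ξ φ} (λ {i} {j} i∈ j∈ 0<σD → corner σ i j i∈ j∈ 0<σD) cs
    where
    open Facts (facts φ)
    open ≤-Reasoning
    ξ′ : Tensor
    ξ′ = ⟦ φ ⟧⁻¹ ∘ₜ ξ
    corner : ∀ σ i j → -I- i → -I- j → 0ℚ < σ * denℚ ξ i j →
      CornerTest σ ξ φ i j
    corner σ i j i∈ j∈ 0<σD =
        0<σD
      , subst (0ℚ <_) (sym eq₀) (*-pos 0<δσD (<-≤-trans 0<½ ½≤))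
      , subst (0ℚ ≤_) (sym eq₊) (*-nonNeg (<⇒≤ 0<δσD) (test (s - r) (p - q) test₊))
      , subst (0ℚ ≤_) (sym eq₋) (*-nonNeg (<⇒≤ 0<δσD) (test (- (r + s)) (p + q) test₋))
      where
      N D z : ℚ
      N = numℚ ξ i j
      D = denℚ ξ i j
      z = N * recip D
      test : ∀ α β → NonNegOn α β → 0ℚ ≤ α * z + β
      test = image-test φ z (into (ι i) (ι j) (ι∈ i∈) (ι∈ j∈))
      0<δσD : 0ℚ < δ * (σ * D)
      0<δσD = *-pos 0<δ 0<σD
      ½≤ : ½ ≤ - r * z + p
      ½≤ = 0≤-⇒≤ (subst (0ℚ ≤_)
        (solve 3 (λ r z p → :- r :* z :+ (p :- con ½) := :- r :* z :+ p :- con ½) refl r z p)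
        (test (- r) (p - ½) test₀))
      N≡ : N ≡ D * z
      N≡ = sym (begin-equality
        D * (N * recip D)  ≡⟨ solve 3 (λ d n u → d :* (n :* u) := n :* (d :* u)) refl D N (recip D) ⟩
        N * (D * recip D)  ≡⟨ cong (N *_) (*-recip (sign-pos⇒≢0 {σ} 0<σD)) ⟩
        N * 1ℚ             ≡⟨ *-identityʳ N ⟩
        N ∎)
      D′≡ : denℚ ξ′ i j ≡ δ * - r * (D * z) + δ * p * D
      D′≡ = trans (den-∘ ⟦ φ ⟧⁻¹ ξ i j) (cong (λ a → δ * - r * a + δ * p * D) N≡)
      N′≡ : numℚ ξ′ i j ≡ δ * s * (D * z) + δ * - q * D
      N′≡ = trans (num-∘ ⟦ φ ⟧⁻¹ ξ i j) (cong (λ a → δ * s * a + δ * - q * D) N≡)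
      eq₀ : σ * denℚ ξ′ i j ≡ δ * (σ * D) * (- r * z + p)
      eq₀ = trans (cong (σ *_) D′≡) (solve 6 (λ σ δ p r D z →
           σ :* (δ :* :- r :* (D :* z) :+ δ :* p :* D) := δ :* (σ :* D) :* (:- r :* z :+ p)) refl σ δ p r D z)
      eq₊ : σ * denℚ ξ′ i j + σ * numℚ ξ′ i j ≡ δ * (σ * D) * ((s - r) * z + (p - q))
      eq₊ = trans (cong₂ (λ a b → σ * a + σ * b) D′≡ N′≡) (solve 8 (λ σ δ p q r s D z →
           σ :* (δ :* :- r :* (D :* z) :+ δ :* p :* D) :+ σ :* (δ :* s :* (D :* z) :+ δ :* :- q :* D)
        := δ :* (σ :* D) :* ((s :- r) :* z :+ (p :- q))) refl σ δ p q r s D z)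
      eq₋ : σ * denℚ ξ′ i j + - σ * numℚ ξ′ i j ≡ δ * (σ * D) * (- (r + s) * z + (p + q))
      eq₋ = trans (cong₂ (λ a b → σ * a + - σ * b) D′≡ N′≡) (solve 8 (λ σ δ p q r s D z →
           σ :* (δ :* :- r :* (D :* z) :+ δ :* p :* D) :+ :- σ :* (δ :* s :* (D :* z) :+ δ :* :- q :* D)
        := δ :* (σ :* D) :* (:- (r :+ s) :* z :+ (p :+ q))) refl σ δ p q r s D z)

abstract
  Incl? : ∀ ξ φ → Dec (Incl ξ φ)
  Incl? ξ φ with Decide.Criterion? 1ℚ ξ φ | Decide.Criterion? (- 1ℚ) ξ φ
  ... | yes c | _     = yes (Decide.sufficient ξ φ Decide.plus c)
  ... | no  _ | yes c = yes (Decide.sufficient ξ φ Decide.minus c)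
  ... | no ¬c | no ¬c′ = no λ incl → refute (Decide.necessary ξ φ incl)
    where
    refute : ¬ (∃[ σ ] (Decide.Sign σ × Decide.Criterion σ ξ φ))
    refute (_ , Decide.plus  , c) = ¬c c
    refute (_ , Decide.minus , c) = ¬c′ c

------------------------------------------------------------------------
-- Productivity

data E-q : Tensor → DIGω → DIGω → Set where
  emit   : ∀ {ξ α β} (φ : DIG) → Incl ξ φ → E-q ξ α β
  absorb : ∀ {ξ α β} → E-q ((ξ •₁ ⟦ hd α ⟧) •₂ ⟦ hd β ⟧) (tl α) (tl β) → E-q ξ α β

m̄-q : ∀ ξ α β → E-q ξ α β → DIG × Tensor × DIGω × DIGω
m̄-q ξ α β t with Incl? ξ L
... | yes _ = L , ⟦ L ⟧⁻¹ ∘ₜ ξ , α , β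
... | no ¬L with Incl? ξ R
...   | yes _ = R , ⟦ R ⟧⁻¹ ∘ₜ ξ , α , β
...   | no ¬R with Incl? ξ M
...     | yes _ = M , ⟦ M ⟧⁻¹ ∘ₜ ξ , α , β
...     | no ¬M with t
...       | emit L incl = contradiction incl ¬L
...       | emit R incl = contradiction incl ¬R
...       | emit M incl = contradiction incl ¬M
...       | absorb t′   = m̄-q ((ξ •₁ ⟦ hd α ⟧) •₂ ⟦ hd β ⟧) (tl α) (tl β) t′

data Ψ-q : ℕ → Tensor → DIGω → DIGω → Set where
  Ψ-zero : ∀ {ξ α β} → E-q ξ α β → Ψ-q zero ξ α β
  Ψ-suc  : ∀ {n ξ α β} (t : E-q ξ α β) →
           let (φ , ξ′ , α′ , β′) = m̄-q ξ α β t in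
           Ψ-q n ξ′ α′ β′ → Ψ-q (suc n) ξ α β

P-q : Tensor → DIGω → DIGω → Set
P-q ξ α β = ∀ n → Ψ-q n ξ α β

{-# OPTIONS --safe #-}
module Submission where

-- A quadratic map is determined by its numerators V and denominators W at the four
-- corners of the square, and it is refining iff, after a common change of sign, W > 0
-- and |V| ≤ W there.  Absorbing a digit combines the corner values with nonnegative
-- weights, so it preserves this condition; emission preserves it too.  The digits are not
-- uniform contractions (L and R have derivative 1 at a fixed point), but each
-- absorption raises by a fixed amount a lower bound for the reciprocal of the distance
-- between the values V / W at adjacent corners.  So after finitely many absorptions the
-- four corner values lie within 1/3 of each other, and some digit can be emitted.

open import Data.Bool using (Bool; true; false)
import Data.Integer as ℤ
import Data.Integer.Properties as ℤ
import Data.Integer.Solver as ℤ-Solver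
open import Data.Nat as ℕ using (ℕ; zero; suc)
import Data.Nat.Properties as ℕ
open import Data.Product using (∃-syntax; _×_; _,_; proj₁; proj₂)
open import Data.Rational
open import Data.Rational.Properties
open import Data.Rational.Solver using (module +-*-Solver)
import Data.Rational.Unnormalised as ℚᵘ
import Data.Rational.Unnormalised.Properties as ℚᵘ
open import Data.Sum using (_⊎_; inj₁; inj₂)
open import Function using (flip)
open import Relation.Binary.PropositionalEquality using (_≡_; _≢_; refl; sym; trans; cong; cong₂; subst; subst₂)
open import Relation.Nullary using (yes; no; contradiction)

open import Defs

open +-*-Solver using (solve; con; _:=_; _:+_; _:*_; _:-_; :-_)

-- The Archimedean property of the rationals.

fromℕ : ℕ → ℚ
fromℕ zero    = 0ℚ
fromℕ (suc n) = 1ℚ + fromℕ n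

toℚᵘ-fromℕ : ∀ n → toℚᵘ (fromℕ n) ℚᵘ.≃ ℚᵘ.mkℚᵘ (ℤ.+ n) 0
toℚᵘ-fromℕ zero    = ℚᵘ.*≡* refl
toℚᵘ-fromℕ (suc n) = ℚᵘ.≃-trans (toℚᵘ-homo-+ 1ℚ (fromℕ n))
  (ℚᵘ.≃-trans (ℚᵘ.+-congʳ ℚᵘ.1ℚᵘ (toℚᵘ-fromℕ n))
    (ℚᵘ.*≡* (S.solve 1 (λ i → (one S.:* one S.:+ i S.:* one) S.:* one S.:= (one S.:+ i) S.:* one) refl (ℤ.+ n))))
  where
  module S = ℤ-Solver.+-*-Solver
  one : ∀ {n} → S.Polynomial n
  one = S.con ℤ.1ℤ

-- The absolute value of the numerator serves, since the denominator is at least 1.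
archimedean : ∀ q → ∃[ n ] q ≤ fromℕ n
archimedean (mkℚ i d-1 _) = ℤ.∣ i ∣ , toℚᵘ-cancel-≤
  (ℚᵘ.≤-trans (ℚᵘ.*≤* (i≤∣i∣d i)) (ℚᵘ.≤-reflexive (ℚᵘ.≃-sym (toℚᵘ-fromℕ ℤ.∣ i ∣))))
  where
  i≤∣i∣d : ∀ i → i ℤ.* ℤ.1ℤ ℤ.≤ ℤ.+ ℤ.∣ i ∣ ℤ.* ℤ.+ suc d-1
  i≤∣i∣d (ℤ.+ n) = subst₂ ℤ._≤_ (sym (ℤ.*-identityʳ (ℤ.+ n))) (ℤ.pos-* n (suc d-1))
    (ℤ.+≤+ (ℕ.m≤m*n n (suc d-1)))
  i≤∣i∣d ℤ.-[1+ n ] = ℤ.-≤+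

-- Inequalities, and conditions on small constants.

*-monoˡ : ∀ {p q r} → 0ℚ ≤ p → q ≤ r → p * q ≤ p * r
*-monoˡ {p} 0≤p = *-monoˡ-≤-nonNeg p {{nonNegative 0≤p}}

*-monoʳ : ∀ {p q r} → 0ℚ ≤ r → p ≤ q → p * r ≤ q * r
*-monoʳ {r = r} 0≤r = *-monoʳ-≤-nonNeg r {{nonNegative 0≤r}}

≤-by : ∀ {p q} d → 0ℚ ≤ d → d ≡ q - p → p ≤ q
≤-by d 0≤d d≡ = 0≤-⇒≤ (subst (0ℚ ≤_) d≡ 0≤d)

-- Closure under decreasing `c` lets a single constant meet finitely many such conditions.
Small : (ℚ → Set) → Set
Small P = ∃[ c ] 0ℚ < c × (∀ {c′} → c′ ≤ c → P c′)

Small-× : ∀ {P Q} → Small P → Small Q → Small (λ c → P c × Q c)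
Small-× (c , 0<c , p) (d , 0<d , q) with ≤-total c d
... | inj₁ c≤d = c , 0<c , λ h → p h , q (≤-trans h c≤d)
... | inj₂ d≤c = d , 0<d , λ h → p (≤-trans h d≤c) , q h

Small-∀ : ∀ {P : Bool → ℚ → Set} → (∀ b → Small (P b)) → Small (λ c → ∀ b → P b c)
Small-∀ {P} h with Small-× {P false} {P true} (h false) (h true)
... | c , 0<c , p = c , 0<c , λ c′≤c → λ { false → proj₁ (p c′≤c) ; true → proj₂ (p c′≤c) }

Small-* : ∀ {x y} → 0ℚ ≤ x → 0ℚ < y → Small (λ c → c * x ≤ y)
-- Dividing `y` by `1ℚ + x` rather than by `x` covers the case `x = 0`.
Small-* {x} {y} 0≤x 0<y with shrink {1ℚ + x} (+-mono-<-≤ 0<1 0≤x) 0<y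
... | c , 0<c , eq = c , 0<c , λ c′≤c → ≤-trans (*-monoʳ 0≤x c′≤c)
      (≤-by c (<⇒≤ 0<c) (trans (solve 2 (λ c x → c := (con 1ℚ :+ x) :* c :- c :* x) refl c x)
        (cong (_- c * x) eq)))

all⊎some : ∀ {P Q : Bool → Set} → (∀ b → P b ⊎ Q b) → (∀ b → P b) ⊎ ∃[ b ] Q b
all⊎some h with h false | h true
... | inj₁ p | inj₁ p′ = inj₁ λ { false → p ; true → p′ }
... | inj₁ _ | inj₂ q  = inj₂ (true , q)
... | inj₂ q | _       = inj₂ (false , q)

-- Corner grids and nonnegative combinations.

Grid : Set
Grid = Bool → Bool → ℚ

all≤0⊎some≥0 : (V : Grid) → (∀ i j → V i j ≤ 0ℚ) ⊎ (∃[ i ] ∃[ j ] 0ℚ ≤ V i j)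
all≤0⊎some≥0 V = all⊎some λ i → all⊎some λ j → ≤-total (V i j) 0ℚ

dot : (a x : Bool → ℚ) → ℚ
dot a x = a false * x false + a true * x true

dot² : (a b : Bool → ℚ) → Grid → ℚ
dot² a b X = dot a (λ k → dot b (X k))

NonNeg : (Bool → ℚ) → Set
NonNeg a = ∀ k → 0ℚ ≤ a k

dot-mono : ∀ {a x y} → NonNeg a → (∀ k → x k ≤ y k) → dot a x ≤ dot a y
dot-mono 0≤a x≤y = +-mono-≤ (*-monoˡ (0≤a false) (x≤y false)) (*-monoˡ (0≤a true) (x≤y true))

dot-nonNeg : ∀ {a x} → NonNeg a → NonNeg x → 0ℚ ≤ dot a x
dot-nonNeg 0≤a 0≤x = +-nonNeg (*-nonNeg (0≤a false) (0≤x false)) (*-nonNeg (0≤a true) (0≤x true))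

dot²-mono : ∀ {a b X Y} → NonNeg a → NonNeg b → (∀ k l → X k l ≤ Y k l) → dot² a b X ≤ dot² a b Y
dot²-mono 0≤a 0≤b X≤Y = dot-mono 0≤a λ k → dot-mono 0≤b (X≤Y k)

∣dot∣ : ∀ {a x} → NonNeg a → ∣ dot a x ∣ ≤ dot a (λ k → ∣ x k ∣)
∣dot∣ {a} {x} 0≤a = ≤-trans (∣p+q∣≤∣p∣+∣q∣ (a false * x false) (a true * x true))
  (≤-reflexive (cong₂ _+_ (term false) (term true)))
  where
  term : ∀ k → ∣ a k * x k ∣ ≡ a k * ∣ x k ∣
  term k = trans (∣p*q∣≡∣p∣*∣q∣ (a k) (x k)) (cong (_* ∣ x k ∣) (0≤p⇒∣p∣≡p (0≤a k)))

∣dot²∣ : ∀ {a b X} → NonNeg a → NonNeg b → ∣ dot² a b X ∣ ≤ dot² a b (λ k l → ∣ X k l ∣)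
∣dot²∣ {a} {b} {X} 0≤a 0≤b = ≤-trans (∣dot∣ {a} {λ k → dot b (X k)} 0≤a) (dot-mono 0≤a λ k → ∣dot∣ {b} {X k} 0≤b)

dot²-* : ∀ a b x y → dot² a b (λ k l → x k * y l) ≡ dot a x * dot b y
dot²-* a b x y = solve 8 (λ a₀ a₁ b₀ b₁ x₀ x₁ y₀ y₁ →
     a₀ :* (b₀ :* (x₀ :* y₀) :+ b₁ :* (x₀ :* y₁)) :+ a₁ :* (b₀ :* (x₁ :* y₀) :+ b₁ :* (x₁ :* y₁))
  := (a₀ :* x₀ :+ a₁ :* x₁) :* (b₀ :* y₀ :+ b₁ :* y₁))
  refl (a false) (a true) (b false) (b true) (x false) (x true) (y false) (y true)

dot²-scale : ∀ a b c X → c * dot² a b X ≡ dot² a b (λ k l → c * X k l)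
dot²-scale a b c X = solve 9 (λ a₀ a₁ b₀ b₁ c x₀₀ x₀₁ x₁₀ x₁₁ →
     c :* (a₀ :* (b₀ :* x₀₀ :+ b₁ :* x₀₁) :+ a₁ :* (b₀ :* x₁₀ :+ b₁ :* x₁₁))
  := a₀ :* (b₀ :* (c :* x₀₀) :+ b₁ :* (c :* x₀₁)) :+ a₁ :* (b₀ :* (c :* x₁₀) :+ b₁ :* (c :* x₁₁)))
  refl (a false) (a true) (b false) (b true) c (X false false) (X false true) (X true false) (X true true)

-- Digits as nonnegative matrices on corner values.

end : Bool → ℚ
end false = - 1ℚ
end true  = 1ℚ

-- The matrix of the absorption of φ in the basis of corner values; its entries are
-- nonnegative because ⟦ φ ⟧ maps [-1,1] into itself with a positive denominator.
weight : DIG → Bool → Bool → ℚ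
weight φ i k = ½ * (r * end i + s + end k * (p * end i + q))
  where open Matrix ⟦ φ ⟧

weight-nonNeg : ∀ φ i → NonNeg (weight φ i)
weight-nonNeg L false false = ≤-dec
weight-nonNeg L false true  = ≤-dec
weight-nonNeg L true  false = ≤-dec
weight-nonNeg L true  true  = ≤-dec
weight-nonNeg R false false = ≤-dec
weight-nonNeg R false true  = ≤-dec
weight-nonNeg R true  false = ≤-dec
weight-nonNeg R true  true  = ≤-dec
weight-nonNeg M false false = ≤-dec
weight-nonNeg M false true  = ≤-dec
weight-nonNeg M true  false = ≤-dec
weight-nonNeg M true  true  = ≤-dec

weight-diagonal : ∀ φ i → 0ℚ < weight φ i i
weight-diagonal L false = <-dec
weight-diagonal L true  = <-dec
weight-diagonal R false = <-dec
weight-diagonal R true  = <-dec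
weight-diagonal M false = <-dec
weight-diagonal M true  = <-dec

detʷ : (A : Grid) → ℚ
detʷ A = A true true * A false false - A true false * A false true

-- `detʷ (weight φ)` equals `det ⟦ φ ⟧`, which is 1 for `L` and `R` and 3 for `M`.
weight-det : ∀ φ → 0ℚ ≤ detʷ (weight φ)
weight-det L = ≤-dec
weight-det R = ≤-dec
weight-det M = ≤-dec

-- The row sums are the denominators of `⟦ φ ⟧` at the ends of the interval. For `i = k` this bounds
-- the derivative there by 1; equality holds at the fixed ends -1 of `L` and 1 of `R`.
weight-rows : ∀ φ i k → detʷ (weight φ) ≤ (weight φ i false + weight φ i true) * (weight φ k false + weight φ k true)
weight-rows L false false = ≤-dec
weight-rows L false true  = ≤-dec
weight-rows L true  false = ≤-dec
weight-rows L true  true  = ≤-dec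
weight-rows R false false = ≤-dec
weight-rows R false true  = ≤-dec
weight-rows R true  false = ≤-dec
weight-rows R true  true  = ≤-dec
weight-rows M false false = ≤-dec
weight-rows M false true  = ≤-dec
weight-rows M true  false = ≤-dec
weight-rows M true  true  = ≤-dec

-- The right side is the total coefficient of products within one row when `W′ false j * W′ true j′`
-- is expanded. That it reaches the determinant is the source of the gain in `Spread-row`.
weight-columns : ∀ φ → detʷ (weight φ) ≤ dot (weight φ false) (weight φ true)
weight-columns L = ≤-dec
weight-columns R = ≤-dec
weight-columns M = ≤-dec

-- Row and column operations, and confinement.

RowOp : DIG → Grid → Grid → Set
RowOp φ X X′ = ∀ i j → X′ i j ≡ dot (weight φ i) (λ k → X k j)

ColOp : DIG → Grid → Grid → Set
ColOp φ X X′ = RowOp φ (flip X) (flip X′)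

record Confined (V W : Grid) : Set where
  field
    W-pos : ∀ i j → 0ℚ < W i j
    lower : ∀ i j → 0ℚ ≤ W i j + V i j
    upper : ∀ i j → 0ℚ ≤ W i j - V i j

Confined-flip : ∀ {V W} → Confined V W → Confined (flip V) (flip W)
Confined-flip c = record { W-pos = flip W-pos ; lower = flip lower ; upper = flip upper }
  where open Confined c

Confined-row : ∀ φ {V W V′ W′} → RowOp φ V V′ → RowOp φ W W′ → Confined V W → Confined V′ W′
Confined-row φ {V} {W} V′≡ W′≡ c = record
  { W-pos = λ i j → subst (0ℚ <_) (sym (W′≡ i j)) (row-pos i j)
  ; lower = λ i j → subst (0ℚ ≤_)
      (trans (solve 6 (λ a b v v′ w w′ → a :* (w :+ v) :+ b :* (w′ :+ v′) := (a :* w :+ b :* w′) :+ (a :* v :+ b :* v′))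
               refl (A i false) (A i true) (V false j) (V true j) (W false j) (W true j))
             (sym (cong₂ _+_ (W′≡ i j) (V′≡ i j))))
      (dot-nonNeg {A i} {λ k → W k j + V k j} (weight-nonNeg φ i) (λ k → lower k j))
  ; upper = λ i j → subst (0ℚ ≤_)
      (trans (solve 6 (λ a b v v′ w w′ → a :* (w :- v) :+ b :* (w′ :- v′) := (a :* w :+ b :* w′) :- (a :* v :+ b :* v′))
               refl (A i false) (A i true) (V false j) (V true j) (W false j) (W true j))
             (sym (cong₂ _-_ (W′≡ i j) (V′≡ i j))))
      (dot-nonNeg {A i} {λ k → W k j - V k j} (weight-nonNeg φ i) (λ k → upper k j))
  }
  where
  open Confined c
  A : Grid
  A = weight φ
  row-pos : ∀ i j → 0ℚ < dot (A i) (λ k → W k j)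
  row-pos false j = +-mono-<-≤ (*-pos (weight-diagonal φ false) (W-pos false j)) (*-nonNeg (weight-nonNeg φ false true) (<⇒≤ (W-pos true j)))
  row-pos true j = +-mono-≤-< (*-nonNeg (weight-nonNeg φ true false) (<⇒≤ (W-pos false j))) (*-pos (weight-diagonal φ true) (W-pos true j))

-- The spread of corner values under absorption.

cross : (V W : Grid) → Grid
cross V W j j′ = V true j * W false j′ - V false j * W true j′

-- With j = j′, strong says that V / W changes by at most 1 / m along column j; the
-- off-diagonal cases of both bounds are what the operations on columns need.
record Spread (c m : ℚ) (V W : Grid) : Set where
  field
    rate   : 0ℚ ≤ c
    margin : 0ℚ ≤ m
    weak   : ∀ j j′ k l → c * ∣ cross V W j j′ ∣ ≤ W k j * W l j′
    strong : ∀ j j′ → m * ∣ cross V W j j′ ∣ ≤ W false j * W true j′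

-- Up to sign, `cross V W j j′` is the determinant with columns `V _ j` and `W _ j′`. A row
-- operation multiplies both columns by `weight φ`, so determinants multiply.
cross-row : ∀ φ {V W V′ W′} → RowOp φ V V′ → RowOp φ W W′ → ∀ j j′ →
            ∣ cross V′ W′ j j′ ∣ ≡ detʷ (weight φ) * ∣ cross V W j j′ ∣
cross-row φ {V} {W} {V′} {W′} V′≡ W′≡ j j′ = trans (cong ∣_∣ eq)
  (trans (∣p*q∣≡∣p∣*∣q∣ (detʷ A) (cross V W j j′)) (cong (_* ∣ cross V W j j′ ∣) (0≤p⇒∣p∣≡p (weight-det φ))))
  where
  A : Grid
  A = weight φ
  eq : cross V′ W′ j j′ ≡ detʷ A * cross V W j j′
  eq = trans
    (cong₂ _-_ (cong₂ _*_ (V′≡ true j) (W′≡ false j′)) (cong₂ _*_ (V′≡ false j) (W′≡ true j′)))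
    (solve 8 (λ a b c d v₀ v₁ w₀ w₁ →
         (c :* v₀ :+ d :* v₁) :* (a :* w₀ :+ b :* w₁) :- (a :* v₀ :+ b :* v₁) :* (c :* w₀ :+ d :* w₁)
      := (d :* a :- c :* b) :* (v₁ :* w₀ :- v₀ :* w₁))
      refl (A false false) (A false true) (A true false) (A true true) (V false j) (V true j) (W false j′) (W true j′))

-- Expand `W′ k j * W′ l j′` over pairs of old rows. For `weak`, every pair is bounded at rate `c`,
-- and `weight-rows` absorbs the determinant. For `strong`, the pair `(false , true)` is bounded
-- with `m` and the other three with `c`; these three supply the additional `c`.
Spread-row : ∀ φ {c m V W V′ W′} → RowOp φ V V′ → RowOp φ W W′ → Spread c m V W → Spread c (m + c) V′ W′
Spread-row φ {c} {m} {V} {W} {V′} {W′} V′≡ W′≡ sp = record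
  { rate   = rate
  ; margin = +-nonNeg margin rate
  ; weak   = weak′
  ; strong = strong′
  }
  where
  open Spread sp
  open ≤-Reasoning
  A : Grid
  A = weight φ
  C : Grid
  C j j′ = ∣ cross V W j j′ ∣
  0≤C : ∀ j j′ → 0ℚ ≤ C j j′
  0≤C j j′ = 0≤∣p∣ (cross V W j j′)
  product : ∀ k l j j′ → dot² (A k) (A l) (λ p q → W p j * W q j′) ≡ W′ k j * W′ l j′
  product k l j j′ = trans (dot²-* (A k) (A l) (λ p → W p j) (λ q → W q j′)) (sym (cong₂ _*_ (W′≡ k j) (W′≡ l j′)))

  weak′ : ∀ j j′ k l → c * ∣ cross V′ W′ j j′ ∣ ≤ W′ k j * W′ l j′
  weak′ j j′ k l = begin
    c * ∣ cross V′ W′ j j′ ∣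
      ≡⟨ cong (c *_) (cross-row φ {V} {W} V′≡ W′≡ j j′) ⟩
    c * (detʷ A * C j j′)
      ≤⟨ *-monoˡ rate (*-monoʳ (0≤C j j′) (weight-rows φ k l)) ⟩
    c * ((A k false + A k true) * (A l false + A l true) * C j j′)
      ≡⟨ solve 6 (λ c a b a′ b′ x → c :* ((a :+ b) :* (a′ :+ b′) :* x)
            := a :* (a′ :* (c :* x) :+ b′ :* (c :* x)) :+ b :* (a′ :* (c :* x) :+ b′ :* (c :* x)))
           refl c (A k false) (A k true) (A l false) (A l true) (C j j′) ⟩
    dot² (A k) (A l) (λ _ _ → c * C j j′)
      ≤⟨ dot²-mono {A k} {A l} (weight-nonNeg φ k) (weight-nonNeg φ l) (weak j j′) ⟩
    dot² (A k) (A l) (λ p q → W p j * W q j′)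
      ≡⟨ product k l j j′ ⟩
    W′ k j * W′ l j′ ∎

  strong′ : ∀ j j′ → (m + c) * ∣ cross V′ W′ j j′ ∣ ≤ W′ false j * W′ true j′
  strong′ j j′ = begin
    (m + c) * ∣ cross V′ W′ j j′ ∣
      ≡⟨ cong ((m + c) *_) (cross-row φ {V} {W} V′≡ W′≡ j j′) ⟩
    (m + c) * (detʷ A * C j j′)
      -- With `a b` and `a′ b′` the two rows of `A`, the coefficient of `m` is
      -- `a b′ = detʷ A + b a′`, and that of `c` is `a a′ + b b′ + b a′`, at least `detʷ A + b a′`
      -- by `weight-columns`.
      ≤⟨ ≤-by _ (*-nonNeg (+-nonNeg
             (*-nonNeg (+-nonNeg margin rate) (*-nonNeg (weight-nonNeg φ false true) (weight-nonNeg φ true false)))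
             (*-nonNeg rate (≤⇒0≤- (weight-columns φ)))) (0≤C j j′))
           (solve 7 (λ m c a b a′ b′ x →
                ((m :+ c) :* (b :* a′) :+ c :* (a :* a′ :+ b :* b′ :- (b′ :* a :- a′ :* b))) :* x
             := a :* (a′ :* (c :* x) :+ b′ :* (m :* x)) :+ b :* (a′ :* (c :* x) :+ b′ :* (c :* x))
                  :- (m :+ c) :* ((b′ :* a :- a′ :* b) :* x))
             refl m c (A false false) (A false true) (A true false) (A true true) (C j j′)) ⟩
    dot² (A false) (A true) bound
      ≤⟨ dot²-mono {A false} {A true} {bound} (weight-nonNeg φ false) (weight-nonNeg φ true) bound≤ ⟩
    dot² (A false) (A true) (λ p q → W p j * W q j′)
      ≡⟨ product false true j j′ ⟩
    W′ false j * W′ true j′ ∎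
    where
    bound : Grid
    bound false true = m * C j j′
    bound false false = c * C j j′
    bound true _ = c * C j j′
    bound≤ : ∀ p q → bound p q ≤ W p j * W q j′
    bound≤ false true = strong j j′
    bound≤ false false = weak j j′ false false
    bound≤ true q = weak j j′ true q

cross-col : ∀ φ {V W V′ W′} → ColOp φ V V′ → ColOp φ W W′ → ∀ j j′ →
            cross V′ W′ j j′ ≡ dot² (weight φ j) (weight φ j′) (cross V W)
cross-col φ {V} {W} {V′} {W′} V′≡ W′≡ j j′ = trans
  (cong₂ _-_ (cong₂ _*_ (V′≡ j true) (W′≡ j′ false)) (cong₂ _*_ (V′≡ j false) (W′≡ j′ true)))
  (solve 12 (λ a b a′ b′ v₁₀ v₁₁ v₀₀ v₀₁ w₁₀ w₁₁ w₀₀ w₀₁ →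
       (a :* v₁₀ :+ b :* v₁₁) :* (a′ :* w₀₀ :+ b′ :* w₀₁) :- (a :* v₀₀ :+ b :* v₀₁) :* (a′ :* w₁₀ :+ b′ :* w₁₁)
    := a :* (a′ :* (v₁₀ :* w₀₀ :- v₀₀ :* w₁₀) :+ b′ :* (v₁₀ :* w₀₁ :- v₀₀ :* w₁₁))
         :+ b :* (a′ :* (v₁₁ :* w₀₀ :- v₀₁ :* w₁₀) :+ b′ :* (v₁₁ :* w₀₁ :- v₀₁ :* w₁₁)))
    refl (weight φ j false) (weight φ j true) (weight φ j′ false) (weight φ j′ true)
    (V true false) (V true true) (V false false) (V false true)
    (W true false) (W true true) (W false false) (W false true))

-- `cross` and the products `W k r * W l s` are both bilinear in the columns and transform by the
-- same nonnegative weights, so the triangle inequality carries each bound over with its constant.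
Spread-col : ∀ φ {c m V W V′ W′} → ColOp φ V V′ → ColOp φ W W′ → Spread c m V W → Spread c m V′ W′
Spread-col φ {c} {m} {V} {W} {V′} {W′} V′≡ W′≡ sp = record
  { rate   = rate
  ; margin = margin
  ; weak   = λ j j′ k l → preserved c k l rate (λ r s → weak r s k l) j j′
  ; strong = preserved m false true margin strong
  }
  where
  open Spread sp
  open ≤-Reasoning
  preserved : ∀ c k l → 0ℚ ≤ c → (∀ r s → c * ∣ cross V W r s ∣ ≤ W k r * W l s) →
              ∀ j j′ → c * ∣ cross V′ W′ j j′ ∣ ≤ W′ k j * W′ l j′
  preserved c k l 0≤c h j j′ = begin
    c * ∣ cross V′ W′ j j′ ∣
      ≡⟨ cong (λ z → c * ∣ z ∣) (cross-col φ {V} {W} V′≡ W′≡ j j′) ⟩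
    c * ∣ dot² B B′ (cross V W) ∣
      ≤⟨ *-monoˡ 0≤c (∣dot²∣ {B} {B′} {cross V W} (weight-nonNeg φ j) (weight-nonNeg φ j′)) ⟩
    c * dot² B B′ (λ r s → ∣ cross V W r s ∣)
      ≡⟨ dot²-scale B B′ c (λ r s → ∣ cross V W r s ∣) ⟩
    dot² B B′ (λ r s → c * ∣ cross V W r s ∣)
      ≤⟨ dot²-mono {B} {B′} (weight-nonNeg φ j) (weight-nonNeg φ j′) h ⟩
    dot² B B′ (λ r s → W k r * W l s)
      ≡⟨ dot²-* B B′ (W k) (W l) ⟩
    dot B (W k) * dot B′ (W l)
      ≡⟨ sym (cong₂ _*_ (W′≡ j k) (W′≡ j′ l)) ⟩
    W′ k j * W′ l j′ ∎
    where
    B B′ : Bool → ℚ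
    B = weight φ j
    B′ = weight φ j′

-- Every product of entries of `W` is positive and there are finitely many bounds, so a small rate
-- satisfies them all. Rate and margin may start equal because `strong` is then an instance of
-- `weak`.
initial-spread : ∀ {V W} → Confined V W → Small (λ c → 0ℚ ≤ c → Spread c c V W)
initial-spread {V} {W} conf = let c , 0<c , h = small in c , 0<c , λ c′≤c 0≤c′ → record
  { rate = 0≤c′ ; margin = 0≤c′ ; weak = h c′≤c ; strong = λ j j′ → h c′≤c j j′ false true }
  where
  open Confined conf
  small : Small (λ c → ∀ j j′ k l → c * ∣ cross V W j j′ ∣ ≤ W k j * W l j′)
  small = Small-∀ λ j → Small-∀ λ j′ → Small-∀ λ k → Small-∀ λ l →
    Small-* (0≤∣p∣ (cross V W j j′)) (*-pos (W-pos k j) (W-pos l j′))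

-- Tensors and their corner grids.

open Decide

num-grid den-grid : ℚ → Tensor → Grid
num-grid σ ξ i j = σ * numℚ ξ (end i) (end j)
den-grid σ ξ i j = σ * denℚ ξ (end i) (end j)

-- The form is affine in its first argument. Homogenised and evaluated at the numerator and
-- denominator of `⟦ φ ⟧`, it combines its values at -1 and 1 with coefficients half of denominator
-- minus, respectively plus, numerator; these are the weights.
bil-•₁ : ∀ σ φ a b c d i y → let open Matrix ⟦ φ ⟧ in
  σ * bil (a * p + c * r) (b * p + d * r) (a * q + c * s) (b * q + d * s) (end i) y ≡
  dot (weight φ i) (λ k → σ * bil a b c d (end k) y)
bil-•₁ σ φ a b c d i y = solve 11 (λ σ a b c d p q r s x y →
  let f x = a :* (x :* y) :+ b :* x :+ c :* y :+ d
      w k = con ½ :* (r :* x :+ s :+ k :* (p :* x :+ q))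
  in σ :* ((a :* p :+ c :* r) :* (x :* y) :+ (b :* p :+ d :* r) :* x :+ (a :* q :+ c :* s) :* y :+ (b :* q :+ d :* s))
     := w (con (- 1ℚ)) :* (σ :* f (con (- 1ℚ))) :+ w (con 1ℚ) :* (σ :* f (con 1ℚ)))
  refl σ a b c d p q r s (end i) y
  where open Matrix ⟦ φ ⟧

bil-•₂ : ∀ σ φ a b c d x j → let open Matrix ⟦ φ ⟧ in
  σ * bil (a * p + b * r) (a * q + b * s) (c * p + d * r) (c * q + d * s) x (end j) ≡
  dot (weight φ j) (λ k → σ * bil a b c d x (end k))
bil-•₂ σ φ a b c d x j = solve 11 (λ σ a b c d p q r s x y →
  let f y = a :* (x :* y) :+ b :* x :+ c :* y :+ d
      w k = con ½ :* (r :* y :+ s :+ k :* (p :* y :+ q))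
  in σ :* ((a :* p :+ b :* r) :* (x :* y) :+ (a :* q :+ b :* s) :* x :+ (c :* p :+ d :* r) :* y :+ (c :* q :+ d :* s))
     := w (con (- 1ℚ)) :* (σ :* f (con (- 1ℚ))) :+ w (con 1ℚ) :* (σ :* f (con 1ℚ)))
  refl σ a b c d p q r s x (end j)
  where open Matrix ⟦ φ ⟧

num-•₁ : ∀ σ φ ξ → RowOp φ (num-grid σ ξ) (num-grid σ (ξ •₁ ⟦ φ ⟧))
num-•₁ σ φ (tensor a b c d e f g h) i j = bil-•₁ σ φ a b c d i (end j)

den-•₁ : ∀ σ φ ξ → RowOp φ (den-grid σ ξ) (den-grid σ (ξ •₁ ⟦ φ ⟧))
den-•₁ σ φ (tensor a b c d e f g h) i j = bil-•₁ σ φ e f g h i (end j)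

num-•₂ : ∀ σ φ ξ → ColOp φ (num-grid σ ξ) (num-grid σ (ξ •₂ ⟦ φ ⟧))
num-•₂ σ φ (tensor a b c d e f g h) j i = bil-•₂ σ φ a b c d (end i) j

den-•₂ : ∀ σ φ ξ → ColOp φ (den-grid σ ξ) (den-grid σ (ξ •₂ ⟦ φ ⟧))
den-•₂ σ φ (tensor a b c d e f g h) j i = bil-•₂ σ φ e f g h (end i) j

Confinedᵗ : ℚ → Tensor → Set
Confinedᵗ σ ξ = Confined (num-grid σ ξ) (den-grid σ ξ)

-- `Spread₁` controls variation in the first argument and `Spread₂` in the second. Transposing
-- exchanges row and column operations, so each absorption raises both margins.
Spread₁ Spread₂ : ℚ → ℚ → ℚ → Tensor → Set
Spread₁ c m σ ξ = Spread c m (num-grid σ ξ) (den-grid σ ξ)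
Spread₂ c m σ ξ = Spread c m (flip (num-grid σ ξ)) (flip (den-grid σ ξ))

Confined-absorb : ∀ σ ξ φ ψ → Confinedᵗ σ ξ → Confinedᵗ σ ((ξ •₁ ⟦ φ ⟧) •₂ ⟦ ψ ⟧)
Confined-absorb σ ξ φ ψ conf = Confined-flip
  (Confined-row ψ (num-•₂ σ ψ ξ′) (den-•₂ σ ψ ξ′)
    (Confined-flip (Confined-row φ (num-•₁ σ φ ξ) (den-•₁ σ φ ξ) conf)))
  where
  ξ′ : Tensor
  ξ′ = ξ •₁ ⟦ φ ⟧

Spread₁-absorb : ∀ {c m} σ ξ φ ψ → Spread₁ c m σ ξ → Spread₁ c (m + c) σ ((ξ •₁ ⟦ φ ⟧) •₂ ⟦ ψ ⟧)
Spread₁-absorb σ ξ φ ψ sp = Spread-col ψ (num-•₂ σ ψ ξ′) (den-•₂ σ ψ ξ′)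
  (Spread-row φ (num-•₁ σ φ ξ) (den-•₁ σ φ ξ) sp)
  where
  ξ′ : Tensor
  ξ′ = ξ •₁ ⟦ φ ⟧

Spread₂-absorb : ∀ {c m} σ ξ φ ψ → Spread₂ c m σ ξ → Spread₂ c (m + c) σ ((ξ •₁ ⟦ φ ⟧) •₂ ⟦ ψ ⟧)
Spread₂-absorb σ ξ φ ψ sp = Spread-row ψ (num-•₂ σ ψ ξ′) (den-•₂ σ ψ ξ′)
  (Spread-col φ (num-•₁ σ φ ξ) (den-•₁ σ φ ξ) sp)
  where
  ξ′ : Tensor
  ξ′ = ξ •₁ ⟦ φ ⟧

-- Emission from nearly equal corner values.

3ℚ 6ℚ : ℚ
3ℚ = ℤ.+ 3 / 1
6ℚ = ℤ.+ 6 / 1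

-- For positive w and w′ this says v / w - v′ / w′ ≤ 1 / c.
Near : (c v w v′ w′ : ℚ) → Set
Near c v w v′ w′ = c * (v * w′ - v′ * w) ≤ w * w′

*-cancel-nonNeg : ∀ {p q} → 0ℚ < p → 0ℚ ≤ p * q → 0ℚ ≤ q
*-cancel-nonNeg {p} {q} 0<p 0≤pq = *-cancelˡ-≤-pos p {{positive 0<p}} (subst (_≤ p * q) (sym (*-zeroʳ p)) 0≤pq)

-- Two differences of at most 1/6 add up to at most 1/3; the common denominator `w′` is cleared and
-- then cancelled.
Near-trans : ∀ v v′ v″ {w w′ w″} → 0ℚ < w → 0ℚ < w′ → 0ℚ < w″ →
             Near 6ℚ v w v′ w′ → Near 6ℚ v′ w′ v″ w″ → Near 3ℚ v w v″ w″
Near-trans v v′ v″ {w} {w′} {w″} 0<w 0<w′ 0<w″ n n′ = 0≤-⇒≤ (*-cancel-nonNeg 0<w′ (subst (0ℚ ≤_)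
  (solve 6 (λ v w v′ w′ v″ w″ →
       con ½ :* ((w :* w′ :- con 6ℚ :* (v :* w′ :- v′ :* w)) :* w″ :+ (w′ :* w″ :- con 6ℚ :* (v′ :* w″ :- v″ :* w′)) :* w)
    := w′ :* (w :* w″ :- con 3ℚ :* (v :* w″ :- v″ :* w))) refl v w v′ w′ v″ w″)
  (*-nonNeg (<⇒≤ 0<½) (+-nonNeg (*-nonNeg (≤⇒0≤- n) (<⇒≤ 0<w″)) (*-nonNeg (≤⇒0≤- n′) (<⇒≤ 0<w))))))

Spread⇒Near : ∀ {c m V W} → 6ℚ ≤ m → Confined V W → Spread c m V W → ∀ i k j → Near 6ℚ (V i j) (W i j) (V k j) (W k j)
Spread⇒Near {c} {m} {V} {W} 6≤m conf sp = near
  where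
  open Spread sp
  open Confined conf
  refl-near : ∀ i j → Near 6ℚ (V i j) (W i j) (V i j) (W i j)
  refl-near i j = ≤-trans (≤-reflexive (solve 2 (λ v w → con 6ℚ :* (v :* w :- v :* w) := con 0ℚ) refl (V i j) (W i j)))
    (*-nonNeg (<⇒≤ (W-pos i j)) (<⇒≤ (W-pos i j)))
  bound : ∀ j → 6ℚ * ∣ cross V W j j ∣ ≤ W false j * W true j
  bound j = ≤-trans (*-monoʳ (0≤∣p∣ (cross V W j j)) 6≤m) (strong j j)
  near : ∀ i k j → Near 6ℚ (V i j) (W i j) (V k j) (W k j)
  near false false j = refl-near false j
  near true true j = refl-near true j
  near true false j = ≤-trans (*-monoˡ {6ℚ} ≤-dec (q≤∣q∣ (cross V W j j)))
    (≤-trans (bound j) (≤-reflexive (*-comm (W false j) (W true j))))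
  near false true j = ≤-trans (*-monoˡ {6ℚ} ≤-dec (q≤∣q∣ (V false j * W true j - V true j * W false j)))
    (≤-trans (≤-reflexive (cong (6ℚ *_) (∣-∣-swap (V false j * W true j) (V true j * W false j)))) (bound j))

corner-test : ∀ {σ} ξ φ i j → let open Matrix ⟦ φ ⟧⁻¹ ; V = num-grid σ ξ i j ; W = den-grid σ ξ i j in
  0ℚ < W → 0ℚ < r * V + s * W → 0ℚ ≤ (s + q) * W + (r + p) * V → 0ℚ ≤ (s - q) * W + (r - p) * V →
  CornerTest σ ξ φ (end i) (end j)
corner-test {σ} ξ φ i j h₁ h₂ h₃ h₄ =
    h₁
  , subst (0ℚ <_) (trans
      (solve 5 (λ σ r s N D → r :* (σ :* N) :+ s :* (σ :* D) := σ :* (r :* N :+ s :* D)) refl σ r s N D)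
      (cong (σ *_) (sym D′≡))) h₂
  , subst (0ℚ ≤_) (trans
      (solve 7 (λ σ p q r s N D → (s :+ q) :* (σ :* D) :+ (r :+ p) :* (σ :* N)
        := σ :* (r :* N :+ s :* D) :+ σ :* (p :* N :+ q :* D)) refl σ p q r s N D)
      (sym (cong₂ (λ a b → σ * a + σ * b) D′≡ N′≡))) h₃
  , subst (0ℚ ≤_) (trans
      (solve 7 (λ σ p q r s N D → (s :- q) :* (σ :* D) :+ (r :- p) :* (σ :* N)
        := σ :* (r :* N :+ s :* D) :+ :- σ :* (p :* N :+ q :* D)) refl σ p q r s N D)
      (sym (cong₂ (λ a b → σ * a + - σ * b) D′≡ N′≡))) h₄
  where
  open Matrix ⟦ φ ⟧⁻¹
  N D : ℚ
  N = numℚ ξ (end i) (end j)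
  D = denℚ ξ (end i) (end j)
  N′≡ : numℚ (⟦ φ ⟧⁻¹ ∘ₜ ξ) (end i) (end j) ≡ p * N + q * D
  N′≡ = num-∘ ⟦ φ ⟧⁻¹ ξ (end i) (end j)
  D′≡ : denℚ (⟦ φ ⟧⁻¹ ∘ₜ ξ) (end i) (end j) ≡ r * N + s * D
  D′≡ = den-∘ ⟦ φ ⟧⁻¹ ξ (end i) (end j)

corners : {P : ℚ → ℚ → Set} → (∀ i j → P (end i) (end j)) → Corners P
corners h = h false false , h false true , h true false , h true true

at-corners : ∀ {P : ℚ → ℚ → Set} → Corners P → ∀ i j → P (end i) (end j)
at-corners (a , b , c , d) false false = a
at-corners (a , b , c , d) false true  = b
at-corners (a , b , c , d) true  false = c
at-corners (a , b , c , d) true  true  = d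

-- For `L` the last two corner tests reduce to `W + V` and `- V - V` being nonnegative, the ends -1
-- and 0 of its image; `lower` already gives the first. `R` is the mirror image.
Incl-L : ∀ {σ} ξ → Sign σ → Confinedᵗ σ ξ → (∀ i j → num-grid σ ξ i j ≤ 0ℚ) → Incl ξ L
Incl-L {σ} ξ ±σ conf V≤0 = sufficient ξ L ±σ (corners {CornerTest σ ξ L} λ i j →
  let V = num-grid σ ξ i j ; W = den-grid σ ξ i j ; 0≤-V = neg-antimono-≤ (V≤0 i j) in
  corner-test {σ} ξ L i j (W-pos i j)
    (subst (0ℚ <_) (solve 2 (λ v w → con ½ :* (w :+ :- v) := con (r ⟦ L ⟧⁻¹) :* v :+ con (s ⟦ L ⟧⁻¹) :* w) refl V W)
      (*-pos 0<½ (+-mono-<-≤ (W-pos i j) 0≤-V)))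
    (subst (0ℚ ≤_) (solve 2 (λ v w → w :+ v := con (s ⟦ L ⟧⁻¹ + q ⟦ L ⟧⁻¹) :* w :+ con (r ⟦ L ⟧⁻¹ + p ⟦ L ⟧⁻¹) :* v) refl V W)
      (lower i j))
    (subst (0ℚ ≤_) (solve 2 (λ v w → :- v :+ :- v := con (s ⟦ L ⟧⁻¹ - q ⟦ L ⟧⁻¹) :* w :+ con (r ⟦ L ⟧⁻¹ - p ⟦ L ⟧⁻¹) :* v) refl V W)
      (+-nonNeg 0≤-V 0≤-V)))
  where
  open Confined conf
  open Matrix

Incl-R : ∀ {σ} ξ → Sign σ → Confinedᵗ σ ξ → (∀ i j → 0ℚ ≤ num-grid σ ξ i j) → Incl ξ R
Incl-R {σ} ξ ±σ conf 0≤V = sufficient ξ R ±σ (corners {CornerTest σ ξ R} λ i j →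
  let V = num-grid σ ξ i j ; W = den-grid σ ξ i j in
  corner-test {σ} ξ R i j (W-pos i j)
    (subst (0ℚ <_) (solve 2 (λ v w → con ½ :* (w :+ v) := con (r ⟦ R ⟧⁻¹) :* v :+ con (s ⟦ R ⟧⁻¹) :* w) refl V W)
      (*-pos 0<½ (+-mono-<-≤ (W-pos i j) (0≤V i j))))
    (subst (0ℚ ≤_) (solve 2 (λ v w → v :+ v := con (s ⟦ R ⟧⁻¹ + q ⟦ R ⟧⁻¹) :* w :+ con (r ⟦ R ⟧⁻¹ + p ⟦ R ⟧⁻¹) :* v) refl V W)
      (+-nonNeg (0≤V i j) (0≤V i j)))
    (subst (0ℚ ≤_) (solve 2 (λ v w → w :- v := con (s ⟦ R ⟧⁻¹ - q ⟦ R ⟧⁻¹) :* w :+ con (r ⟦ R ⟧⁻¹ - p ⟦ R ⟧⁻¹) :* v) refl V W)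
      (upper i j)))
  where
  open Confined conf
  open Matrix

Incl-M : ∀ {σ} ξ → Sign σ → Confinedᵗ σ ξ →
         (∀ i j → 0ℚ ≤ den-grid σ ξ i j + 3ℚ * num-grid σ ξ i j) →
         (∀ i j → 0ℚ ≤ den-grid σ ξ i j - 3ℚ * num-grid σ ξ i j) → Incl ξ M
Incl-M {σ} ξ ±σ conf lo hi = sufficient ξ M ±σ (corners {CornerTest σ ξ M} λ i j →
  let V = num-grid σ ξ i j ; W = den-grid σ ξ i j in
  corner-test {σ} ξ M i j (W-pos i j)
    (subst (0ℚ <_) (solve 2 (λ v w → con ⅓ :* w := con (r ⟦ M ⟧⁻¹) :* v :+ con (s ⟦ M ⟧⁻¹) :* w) refl V W)
      (*-pos {⅓} <-dec (W-pos i j)))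
    (subst (0ℚ ≤_) (solve 2 (λ v w → con ⅓ :* (w :+ con 3ℚ :* v)
        := con (s ⟦ M ⟧⁻¹ + q ⟦ M ⟧⁻¹) :* w :+ con (r ⟦ M ⟧⁻¹ + p ⟦ M ⟧⁻¹) :* v) refl V W)
      (*-nonNeg {⅓} ≤-dec (lo i j)))
    (subst (0ℚ ≤_) (solve 2 (λ v w → con ⅓ :* (w :- con 3ℚ :* v)
        := con (s ⟦ M ⟧⁻¹ - q ⟦ M ⟧⁻¹) :* w :+ con (r ⟦ M ⟧⁻¹ - p ⟦ M ⟧⁻¹) :* v) refl V W)
      (*-nonNeg {⅓} ≤-dec (hi i j))))
  where
  open Confined conf
  open Matrix
  ⅓ : ℚ
  ⅓ = ℤ.+ 1 / 3

-- The digit images [-1,0], [0,1] and [-1/3,1/3] are such that every subinterval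
-- of [-1,1] of length at most 1/3 lies in one of them.
some-digit : ∀ {σ} ξ → Sign σ → Confinedᵗ σ ξ →
             (∀ i j k l → Near 3ℚ (num-grid σ ξ i j) (den-grid σ ξ i j) (num-grid σ ξ k l) (den-grid σ ξ k l)) →
             ∃[ φ ] Incl ξ φ
some-digit {σ} ξ ±σ conf near with all≤0⊎some≥0 (num-grid σ ξ) | all≤0⊎some≥0 (λ i j → - num-grid σ ξ i j)
... | inj₁ V≤0 | _ = L , Incl-L ξ ±σ conf V≤0
... | inj₂ _ | inj₁ -V≤0 = R , Incl-R ξ ±σ conf (λ i j → neg-cancel-≤ (-V≤0 i j))
  where
  neg-cancel-≤ : ∀ {q} → - q ≤ 0ℚ → 0ℚ ≤ q
  neg-cancel-≤ {q} h = subst (0ℚ ≤_) (solve 1 (λ q → :- :- q := q) refl q) (neg-antimono-≤ h)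
-- Some corner value is at least 0 and some is at most 0. Every corner value is within 1/3 of both,
-- hence lies in [-1/3,1/3].
... | inj₂ (i , j , 0≤V) | inj₂ (k , l , 0≤-V) = M , Incl-M ξ ±σ conf
  (λ a b → *-cancel-nonNeg (W-pos i j) (subst (0ℚ ≤_)
    (solve 4 (λ v w v′ w′ → (w :* w′ :- con 3ℚ :* (v :* w′ :- v′ :* w)) :+ con 3ℚ :* (v :* w′)
        := w :* (w′ :+ con 3ℚ :* v′)) refl (V i j) (W i j) (V a b) (W a b))
    (+-nonNeg (≤⇒0≤- (near i j a b)) (*-nonNeg {3ℚ} ≤-dec (*-nonNeg 0≤V (<⇒≤ (W-pos a b)))))))
  (λ a b → *-cancel-nonNeg (W-pos k l) (subst (0ℚ ≤_)
    (solve 4 (λ v w v′ w′ → (w :* w′ :- con 3ℚ :* (v :* w′ :- v′ :* w)) :+ con 3ℚ :* (:- v′ :* w)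
        := w′ :* (w :- con 3ℚ :* v)) refl (V a b) (W a b) (V k l) (W k l))
    (+-nonNeg (≤⇒0≤- (near a b k l)) (*-nonNeg {3ℚ} ≤-dec (*-nonNeg 0≤-V (<⇒≤ (W-pos a b)))))))
  where
  open Confined conf
  V W : Grid
  V = num-grid σ ξ
  W = den-grid σ ξ

-- Counting absorptions until emission.

E-q-emits : ∀ {σ c₁ c₂ m₁ m₂ α β} ξ → Sign σ → Confinedᵗ σ ξ → Spread₁ c₁ m₁ σ ξ → Spread₂ c₂ m₂ σ ξ →
            6ℚ ≤ m₁ → 6ℚ ≤ m₂ → E-q ξ α β
E-q-emits {σ} ξ ±σ conf sp₁ sp₂ 6≤m₁ 6≤m₂ = let
  -- Corners are compared through `(k , j)`, changing one coordinate at a time.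
  φ , incl = some-digit ξ ±σ conf λ i j k l → Near-trans (num-grid σ ξ i j) (num-grid σ ξ k j) (num-grid σ ξ k l)
    (W-pos i j) (W-pos k j) (W-pos k l)
    (Spread⇒Near 6≤m₁ conf sp₁ i k j) (Spread⇒Near 6≤m₂ (Confined-flip conf) sp₂ j l k)
  in emit φ incl
  where open Confined conf

-- Each absorption moves one `c` from the term `fromℕ n * c` into the margin. As `absorb` has no
-- side condition, the derivation may continue past the first possible emission.
E-q-within : ∀ n {σ c m} ξ α β → Sign σ → Confinedᵗ σ ξ → Spread₁ c m σ ξ → Spread₂ c m σ ξ →
             6ℚ ≤ m + fromℕ n * c → E-q ξ α β
E-q-within zero {c = c} {m} ξ α β ±σ conf sp₁ sp₂ h = E-q-emits ξ ±σ conf sp₁ sp₂ 6≤m 6≤m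
  where
  6≤m : 6ℚ ≤ m
  6≤m = subst (6ℚ ≤_) (solve 2 (λ m c → m :+ con 0ℚ :* c := m) refl m c) h
E-q-within (suc n) {σ} {c} {m} ξ α β ±σ conf sp₁ sp₂ h = absorb (E-q-within n _ (tl α) (tl β) ±σ
  (Confined-absorb σ ξ (hd α) (hd β) conf)
  (Spread₁-absorb σ ξ (hd α) (hd β) sp₁) (Spread₂-absorb σ ξ (hd α) (hd β) sp₂)
  (subst (6ℚ ≤_) (solve 3 (λ m n c → m :+ (con 1ℚ :+ n) :* c := m :+ c :+ n :* c) refl m (fromℕ n) c) h))

-- The corner condition: productivity and invariance.

Refiningᶜ : Tensor → Set
Refiningᶜ ξ = ∃[ σ ] Sign σ × Confinedᵗ σ ξ

productive : ∀ ξ α β → Refiningᶜ ξ → E-q ξ α β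
productive ξ α β (σ , ±σ , conf) = let
  c , 0<c , small = Small-× (initial-spread conf) (initial-spread (Confined-flip conf))
  sp₁ , sp₂ = small ≤-refl
  -- With `n` at least 6 / `c`, the gains alone reach 6, whatever the initial margin.
  n , 6/c≤n = archimedean (6ℚ * recip c)
  6/c*c≡6 : 6ℚ * recip c * c ≡ 6ℚ
  6/c*c≡6 = trans (*-assoc 6ℚ (recip c) c)
    (trans (cong (6ℚ *_) (trans (*-comm (recip c) c) (*-recip (<⇒≢0 0<c)))) (*-identityʳ 6ℚ))
  in E-q-within n ξ α β ±σ conf (sp₁ (<⇒≤ 0<c)) (sp₂ (<⇒≤ 0<c))
       (≤-trans (subst (_≤ fromℕ n * c) 6/c*c≡6 (*-monoʳ (<⇒≤ 0<c) 6/c≤n))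
         (≤-trans (≤-reflexive (sym (+-identityˡ (fromℕ n * c)))) (+-monoˡ-≤ (fromℕ n * c) (<⇒≤ 0<c))))

-- The last three conditions of `CornerTest` are confinement of `⟦ φ ⟧⁻¹ ∘ₜ ξ`, so necessity of the
-- decision criterion gives the result.
Refiningᶜ-∘ : ∀ ξ φ → Incl ξ φ → Refiningᶜ (⟦ φ ⟧⁻¹ ∘ₜ ξ)
Refiningᶜ-∘ ξ φ incl = let
  σ , ±σ , crit = necessary ξ φ incl
  test = at-corners {CornerTest σ ξ φ} crit
  ξ′ = ⟦ φ ⟧⁻¹ ∘ₜ ξ
  in σ , ±σ , record
    { W-pos = λ i j → proj₁ (proj₂ (test i j))
    ; lower = λ i j → proj₁ (proj₂ (proj₂ (test i j)))
    ; upper = λ i j → subst (0ℚ ≤_)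
        (cong (den-grid σ ξ′ i j +_) (sym (neg-distribˡ-* σ (numℚ ξ′ (end i) (end j)))))
        (proj₂ (proj₂ (proj₂ (test i j))))
    }

-- The case split repeats that of `m̄-q`, so that the goal reduces in each branch.
Refiningᶜ-m̄ : ∀ ξ α β (t : E-q ξ α β) → Refiningᶜ ξ → Refiningᶜ (proj₁ (proj₂ (m̄-q ξ α β t)))
Refiningᶜ-m̄ ξ α β t (σ , ±σ , conf) with Incl? ξ L
... | yes incl = Refiningᶜ-∘ ξ L incl
... | no ¬L with Incl? ξ R
...   | yes incl = Refiningᶜ-∘ ξ R incl
...   | no ¬R with Incl? ξ M
...     | yes incl = Refiningᶜ-∘ ξ M incl
...     | no ¬M with t
...       | emit L incl = contradiction incl ¬L
...       | emit R incl = contradiction incl ¬R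
...       | emit M incl = contradiction incl ¬M
...       | absorb t′   = Refiningᶜ-m̄ _ (tl α) (tl β) t′ (σ , ±σ , Confined-absorb σ ξ (hd α) (hd β) conf)

-- The derivation `t` stays a variable here, so `m̄-q` is not applied to the term built by
-- `productive`.
Ψ-step : ∀ {n} ξ α β → (∀ ξ α β → Refiningᶜ ξ → Ψ-q n ξ α β) → E-q ξ α β → Refiningᶜ ξ → Ψ-q (suc n) ξ α β
Ψ-step ξ α β ih t ref = Ψ-suc t (ih _ _ _ (Refiningᶜ-m̄ ξ α β t ref))

Refiningᶜ⇒Ψ : ∀ n ξ α β → Refiningᶜ ξ → Ψ-q n ξ α β
Refiningᶜ⇒Ψ zero    ξ α β ref = Ψ-zero (productive ξ α β ref)
Refiningᶜ⇒Ψ (suc n) ξ α β ref = Ψ-step ξ α β (Refiningᶜ⇒Ψ n) (productive ξ α β ref) ref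

-- From refining maps to the corner condition.

≤-limit : ∀ {p q} → (∀ ε → 0ℚ < ε → p ≤ q + ε) → p ≤ q
≤-limit {p} {q} h = ≮⇒≥ λ q<p → let
  ε , 0<ε , ε+ε≡ = halve (subst (_< p - q) (+-inverseʳ q) (+-monoˡ-< (- q) q<p))
  in <-irrefl refl (<-≤-trans 0<ε (≤-by (q + ε - p) (≤⇒0≤- (h ε 0<ε))
       (trans (solve 3 (λ p q ε → q :+ ε :- p := ε :- (p :- q)) refl p q ε)
         (trans (cong (λ d → ε - d) (sym ε+ε≡)) (solve 1 (λ ε → ε :- (ε :+ ε) := con 0ℚ :- ε) refl ε)))))

-- Stated for any `x` with constant terms: `eval` at rational points has a constant sequence without
-- being literally `ι q`.
[-1,1]-ι⁻¹ : ∀ {x} q → (∀ n → seq x n ≡ q) → [-1,1] x → -I- q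
[-1,1]-ι⁻¹ {x} q x≡q (lo , hi) =
    ≤-limit (λ ε 0<ε → let N , h = lo ε 0<ε in subst (λ z → - 1ℚ ≤ z + ε) (x≡q N) (h N ℕ.≤-refl))
  , ≤-limit (λ ε 0<ε → let N , h = hi ε 0<ε in subst (_≤ 1ℚ + ε) (x≡q N) (h N ℕ.≤-refl))

end∈ : ∀ i → -I- (end i)
end∈ false = -1∈
end∈ true  = 1∈

-- A nonvanishing denominator has one sign `σ` at all corners; multiplying -1 ≤ `z` ≤ 1 for a corner
-- value `z` by the positive `σ * D` gives `lower` and `upper`.
Refining⇒Refiningᶜ : ∀ ξ → Refining ξ → Refiningᶜ ξ
Refining⇒Refiningᶜ ξ (bd , into) = let
  σ , ±σ , cs = common-sign ξ (bounded-≢0 ξ bd)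
  W-pos = at-corners {λ x y → 0ℚ < σ * denℚ ξ x y} cs
  in σ , ±σ , record
    { W-pos = W-pos
    ; lower = λ i j → subst (0ℚ ≤_)
        (trans (solve 3 (λ σ D z → σ :* D :* (z :- con (- 1ℚ)) := σ :* D :+ σ :* (D :* z)) refl σ (D i j) (z i j))
          (cong (λ a → σ * D i j + σ * a) (D*z≡N i j (sign-pos⇒≢0 {σ} (W-pos i j)))))
        (*-nonNeg (<⇒≤ (W-pos i j)) (≤⇒0≤- (proj₁ (z∈ i j))))
    ; upper = λ i j → subst (0ℚ ≤_)
        (trans (solve 3 (λ σ D z → σ :* D :* (con 1ℚ :- z) := σ :* D :- σ :* (D :* z)) refl σ (D i j) (z i j))
          (cong (λ a → σ * D i j - σ * a) (D*z≡N i j (sign-pos⇒≢0 {σ} (W-pos i j)))))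
        (*-nonNeg (<⇒≤ (W-pos i j)) (≤⇒0≤- (proj₂ (z∈ i j))))
    }
  where
  N D z : Grid
  N i j = numℚ ξ (end i) (end j)
  D i j = denℚ ξ (end i) (end j)
  z i j = N i j * recip (D i j)
  D*z≡N : ∀ i j → D i j ≢ 0ℚ → D i j * z i j ≡ N i j
  D*z≡N i j D≢0 = trans (solve 3 (λ d n u → d :* (n :* u) := n :* (d :* u)) refl (D i j) (N i j) (recip (D i j)))
    (trans (cong (N i j *_) (*-recip D≢0)) (*-identityʳ (N i j)))
  z∈ : ∀ i j → -I- (z i j)
  z∈ i j = [-1,1]-ι⁻¹ {eval ξ (ι (end i)) (ι (end j)) (bd (ι (end i)) (ι (end j)) (ι∈ (end∈ i)) (ι∈ (end∈ j)))} (z i j) (λ _ → refl)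
    (into (ι (end i)) (ι (end j)) (ι∈ (end∈ i)) (ι∈ (end∈ j)))

corollary6p20 : (ξ : Tensor) → Refining ξ → (α β : DIGω) → P-q ξ α β
corollary6p20 ξ ref α β n = Refiningᶜ⇒Ψ n ξ α β (Refining⇒Refiningᶜ ξ ref)
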